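{- Let $\Gamma$ be a strongly regular graph with parameters $(v,k,\lambda,\mu)$ having smallest eigenvalue $-m$. Assume that $k\geqslant m^2(4m-5)$ and that $\Gamma$ contains a Delsarte clique, i.e. a clique of order exactly $1+\frac{k}{m}$. Then either $$\mu \leqslant \frac{k+m^2 - \sqrt{(k+m^2)(k-4m^3+5m^2)}}{2}\quad\text{or}\quad \mu \geqslant \frac{k+m^2 + \sqrt{(k+m^2)(k-4m^3+5m^2)}}{2}.$$
   Context: All graphs are finite, undirected and simple. A regular graph with $v$ vertices and valency $k$ is edge-regular with parameters $(v,k,\lambda)$ if any two adjacent vertices have exactly $\lambda$ common neighbors. An edge-regular graph with parameters $(v,k,\lambda)$ is amply regular with parameters $(v,k,\lambda,\mu)$ if any two vertices at distance $2$ have exactly $\mu$ common neighbors. A strongly regular graph with parameters $(v,k,\lambda,\mu)$ is an amply regular graph with parameters $(v,k,\lambda,\mu)$ with diameter at most $2$. Eigenvalues of a graph are the eigenvalues of its adjacency matrix. A clique is a set of pairwise adjacent vertices, and its order is its number of vertices. In a strongly regular graph with valency $k$ and smallest eigenvalue $-m$, every clique has order at most $1+\frac{k}{m}$ (the Delsarte bound); a clique attaining equality is called a Delsarte clique.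
   Formalization: The graph is additionally assumed not to be complete: a complete graph has no vertices at distance 2, so μ would be arbitrary and the claim would fail (e.g. the triangle with k = 2, m = 1, μ = 1, where the bounds are 0 and 3). -}

module Defs where

open import Level using (0ℓ)
open import Algebra.Bundles using (CommutativeRing)
import Algebra.Properties.Ring as RingProperties
import Algebra.Properties.Monoid.Mult as Mult
import Algebra.Properties.Monoid.Sum as Sum
import Algebra.Solver.Ring.NaturalCoefficients.Default as SemiringSolver
open import Data.Bool.Base using (if_then_else_)
open import Data.Fin.Base using (Fin)
open import Data.Fin.Subset using (Subset; _∈_; _∩_; ∣_∣)
open import Data.Nat.Base as ℕ using (ℕ; zero; suc)
open import Data.Product.Base using (Σ-syntax; ∃; ∃-syntax; _×_; _,_; proj₁; proj₂)
open import Data.Sum.Base using (inj₁; inj₂)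
open import Data.Vec.Base using (tabulate)
open import Relation.Binary.Bundles using (Poset)
open import Relation.Binary.Core using (Rel)
open import Relation.Binary.Definitions using (Decidable; Symmetric; Irreflexive)
open import Relation.Binary.PropositionalEquality.Core using (_≡_; _≢_)
import Relation.Binary.Reasoning.PartialOrder as PosetReasoning
open import Relation.Binary.Structures using (IsDecTotalOrder)
open import Relation.Nullary using (¬_; yes; no; does; contradiction)
open import Relation.Unary using (Pred)

-- The library has no real numbers.  The real field is taken in its classical
-- axiomatic form, a Dedekind-complete ordered field, which determines it up to
-- isomorphism; results about ℝ are stated for an arbitrary model.
-- As usual in classical mathematics, equality and order are decidable, and
-- the value of x ⁻¹ at x ≈ 0 is left unspecified.
record RealNumbers : Set₁ where
  infix  4 _≤_
  infix  8 _⁻¹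
  infixl 7 _/_
  field
    commutativeRing : CommutativeRing 0ℓ 0ℓ

  open CommutativeRing commutativeRing public

  field
    _≤_             : Rel Carrier 0ℓ
    isDecTotalOrder : IsDecTotalOrder _≈_ _≤_
    +-monoʳ-≤       : ∀ z {x y} → x ≤ y → z + x ≤ z + y
    *-nonneg        : ∀ {x y} → 0# ≤ x → 0# ≤ y → 0# ≤ x * y
    0≉1             : ¬ 0# ≈ 1#
    _⁻¹             : Carrier → Carrier
    ⁻¹-cong         : ∀ {x y} → x ≈ y → x ⁻¹ ≈ y ⁻¹
    *-inverseʳ      : ∀ {x} → ¬ x ≈ 0# → x * x ⁻¹ ≈ 1#

  UpperBound : Pred Carrier 0ℓ → Carrier → Set
  UpperBound P b = ∀ y → P y → y ≤ b

  field
    complete : (P : Pred Carrier 0ℓ) → ∃ P → ∃ (UpperBound P) →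
               ∃[ s ] UpperBound P s × (∀ b → UpperBound P b → s ≤ b)

  open IsDecTotalOrder isDecTotalOrder public
    using (_≟_; _≤?_; total; antisym; isPartialOrder)
    renaming (trans to ≤-trans; reflexive to ≤-reflexive; refl to ≤-refl)

  _/_ : Carrier → Carrier → Carrier
  x / y = x * y ⁻¹

  fromℕ : ℕ → Carrier
  fromℕ n = n ×′ 1#
    where open Mult +-monoid using () renaming (_×_ to _×′_)

  poset : Poset 0ℓ 0ℓ 0ℓ
  poset = record { isPartialOrder = isPartialOrder }

  private
    open PosetReasoning poset
    open SemiringSolver commutativeSemiring using (solve; _:+_; _:*_; _:=_; con)
    open RingProperties ring using (-‿distribˡ-*; -‿distribʳ-*; -‿involutive)

    +-monoˡ-≤ : ∀ z {x y} → x ≤ y → x + z ≤ y + z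
    +-monoˡ-≤ z {x} {y} x≤y = begin
      x + z ≈⟨ +-comm x z ⟩
      z + x ≤⟨ +-monoʳ-≤ z x≤y ⟩
      z + y ≈⟨ +-comm z y ⟩
      y + z ∎

    split : ∀ x y → x ≈ y + (x - y)
    split x y = sym (begin-equality
      y + (x - y)   ≈⟨ +-congˡ (+-comm x (- y)) ⟩
      y + (- y + x) ≈⟨ +-assoc y (- y) x ⟨
      y - y + x     ≈⟨ +-congʳ (-‿inverseʳ y) ⟩
      0# + x        ≈⟨ +-identityˡ x ⟩
      x             ∎)

    ≤⇒0≤- : ∀ {x y} → x ≤ y → 0# ≤ y - x
    ≤⇒0≤- {x} {y} x≤y = begin
      0#    ≈⟨ -‿inverseʳ x ⟨
      x - x ≤⟨ +-monoˡ-≤ (- x) x≤y ⟩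
      y - x ∎

    m≤m+n : ∀ {x y} → 0# ≤ y → x ≤ x + y
    m≤m+n {x} {y} 0≤y = begin
      x      ≈⟨ +-identityʳ x ⟨
      x + 0# ≤⟨ +-monoʳ-≤ x 0≤y ⟩
      x + y  ∎

    *-monoˡ-≤ : ∀ {c x y} → 0# ≤ c → x ≤ y → c * x ≤ c * y
    *-monoˡ-≤ {c} {x} {y} 0≤c x≤y = begin
      c * x               ≤⟨ m≤m+n (*-nonneg 0≤c (≤⇒0≤- x≤y)) ⟩
      c * x + c * (y - x) ≈⟨ distribˡ c x (y - x) ⟨
      c * (x + (y - x))   ≈⟨ *-congˡ (split y x) ⟨
      c * y               ∎

    sq-nonneg : ∀ x → 0# ≤ x * x
    sq-nonneg x with total 0# x
    ... | inj₁ 0≤x = *-nonneg 0≤x 0≤x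
    ... | inj₂ x≤0 = begin
      0#            ≤⟨ *-nonneg 0≤-x 0≤-x ⟩
      - x * - x     ≈⟨ -‿distribˡ-* x (- x) ⟨
      - (x * - x)   ≈⟨ -‿cong (-‿distribʳ-* x x) ⟨
      - (- (x * x)) ≈⟨ -‿involutive (x * x) ⟩
      x * x         ∎
      where
      0≤-x : 0# ≤ - x
      0≤-x = begin
        0#     ≤⟨ ≤⇒0≤- x≤0 ⟩
        0# - x ≈⟨ +-identityˡ (- x) ⟩
        - x    ∎

    0≤1 : 0# ≤ 1#
    0≤1 = begin
      0#      ≤⟨ sq-nonneg 1# ⟩
      1# * 1# ≈⟨ *-identityˡ 1# ⟩
      1#      ∎

    ⁻¹-nonneg : ∀ {x} → 0# ≤ x → ¬ x ≈ 0# → 0# ≤ x ⁻¹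
    ⁻¹-nonneg {x} 0≤x x≉0 with total 0# (x ⁻¹)
    ... | inj₁ 0≤x⁻¹ = 0≤x⁻¹
    ... | inj₂ x⁻¹≤0 = contradiction (antisym 0≤1 1≤0) 0≉1
      where
      1≤0 : 1# ≤ 0#
      1≤0 = begin
        1#       ≈⟨ *-inverseʳ x≉0 ⟨
        x * x ⁻¹ ≤⟨ *-monoˡ-≤ 0≤x x⁻¹≤0 ⟩
        x * 0#   ≈⟨ zeroʳ x ⟩
        0#       ∎

    cancel-⁻¹ : ∀ {c} x → ¬ c ≈ 0# → c * (c ⁻¹ * x) ≈ x
    cancel-⁻¹ {c} x c≉0 = begin-equality
      c * (c ⁻¹ * x) ≈⟨ *-assoc c (c ⁻¹) x ⟨
      c * c ⁻¹ * x   ≈⟨ *-congʳ (*-inverseʳ c≉0) ⟩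
      1# * x         ≈⟨ *-identityˡ x ⟩
      x              ∎

    *-cancelˡ-≤ : ∀ {c x y} → 0# ≤ c → ¬ c ≈ 0# → c * x ≤ c * y → x ≤ y
    *-cancelˡ-≤ {c} {x} {y} 0≤c c≉0 cx≤cy = begin
      x              ≈⟨ cancel x ⟨
      c ⁻¹ * (c * x) ≤⟨ *-monoˡ-≤ (⁻¹-nonneg 0≤c c≉0) cx≤cy ⟩
      c ⁻¹ * (c * y) ≈⟨ cancel y ⟩
      y              ∎
      where
      cancel : ∀ z → c ⁻¹ * (c * z) ≈ z
      cancel z = trans (solve 3 (λ a b d → a :* (b :* d) := b :* (a :* d)) refl (c ⁻¹) c z)
                       (cancel-⁻¹ z c≉0)

    +-cancelˡ-≤ : ∀ z {x y} → z + x ≤ z + y → x ≤ y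
    +-cancelˡ-≤ z {x} {y} h = begin
      x             ≈⟨ lem x ⟨
      - z + (z + x) ≤⟨ +-monoʳ-≤ (- z) h ⟩
      - z + (z + y) ≈⟨ lem y ⟩
      y             ∎
      where
      lem : ∀ w → - z + (z + w) ≈ w
      lem w = trans (sym (+-assoc (- z) z w))
                    (trans (+-congʳ (-‿inverseˡ z)) (+-identityˡ w))

    +-nonneg-zeroˡ : ∀ {x y} → 0# ≤ x → 0# ≤ y → x + y ≈ 0# → x ≈ 0#
    +-nonneg-zeroˡ {x} {y} 0≤x 0≤y eq = antisym (≤-trans (m≤m+n 0≤y) (≤-reflexive eq)) 0≤x

    2xy≤x²+y² : ∀ x y → (x + x) * y ≤ x * x + y * y
    2xy≤x²+y² x y = begin
      (x + x) * y                      ≈⟨ *-congʳ (+-cong x≈ x≈) ⟩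
      (y + d + (y + d)) * y            ≤⟨ m≤m+n (sq-nonneg d) ⟩
      (y + d + (y + d)) * y + d * d    ≈⟨ solve 2 (λ y d →
                                            (y :+ d :+ (y :+ d)) :* y :+ d :* d :=
                                            (y :+ d) :* (y :+ d) :+ y :* y) refl y d ⟩
      (y + d) * (y + d) + y * y        ≈⟨ +-congʳ (*-cong x≈ x≈) ⟨
      x * x + y * y                    ∎
      where
      d = x - y
      x≈ = split x y

    4xy≤[x+y]² : ∀ x y → (x + x) * (y + y) ≤ (x + y) * (x + y)
    4xy≤[x+y]² x y = begin
      (x + x) * (y + y)                         ≈⟨ solve 2 (λ x y →
                                                     (x :+ x) :* (y :+ y) :=
                                                     (x :+ x) :* y :+ (x :* y :+ y :* x)) refl x y ⟩
      (x + x) * y + (x * y + y * x)             ≤⟨ +-monoˡ-≤ _ (2xy≤x²+y² x y) ⟩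
      x * x + y * y + (x * y + y * x)           ≈⟨ solve 2 (λ x y →
                                                     x :* x :+ y :* y :+ (x :* y :+ y :* x) :=
                                                     (x :+ y) :* (x :+ y)) refl x y ⟩
      (x + y) * (x + y)                         ∎

  -- s is the supremum of { y ∣ y² ≤ x }; the two inequalities come from
  -- comparing s with (s² + x) / 2s and with 2sx / (s² + x).
  sqrt : ∀ x → 0# ≤ x → ∃[ s ] 0# ≤ s × s * s ≈ x
  sqrt x 0≤x = s , 0≤s , antisym s²≤x x≤s²
    where
    P : Pred Carrier 0ℓ
    P y = y * y ≤ x

    P0 : P 0#
    P0 = ≤-trans (≤-reflexive (zeroˡ 0#)) 0≤x

    bound : UpperBound P (1# + x)
    bound y y²≤x with total y 1#
    ... | inj₁ y≤1 = ≤-trans y≤1 (m≤m+n 0≤x)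
    ... | inj₂ 1≤y = begin
      y      ≈⟨ *-identityʳ y ⟨
      y * 1# ≤⟨ *-monoˡ-≤ (≤-trans 0≤1 1≤y) 1≤y ⟩
      y * y  ≤⟨ y²≤x ⟩
      x      ≤⟨ m≤m+n 0≤1 ⟩
      x + 1# ≈⟨ +-comm x 1# ⟩
      1# + x ∎

    sup = complete P (0# , P0) (1# + x , bound)
    s = proj₁ sup
    upper = proj₁ (proj₂ sup)
    least = proj₂ (proj₂ sup)

    0≤s : 0# ≤ s
    0≤s = upper 0# P0

    s²≤x : s * s ≤ x
    s²≤x with s ≟ 0#
    ... | yes s≈0 = ≤-trans (≤-reflexive (trans (*-congʳ s≈0) (zeroˡ s))) 0≤x
    ... | no  s≉0 = +-cancelˡ-≤ (s * s) (begin
      s * s + s * s                         ≈⟨ distribʳ s s s ⟨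
      (s + s) * s                           ≤⟨ *-monoˡ-≤ 0≤2s (least _ t-upper) ⟩
      (s + s) * ((s + s) ⁻¹ * (s * s + x))  ≈⟨ cancel-⁻¹ _ 2s≉0 ⟩
      s * s + x                             ∎)
      where
      0≤2s : 0# ≤ s + s
      0≤2s = ≤-trans 0≤s (m≤m+n 0≤s)

      2s≉0 : ¬ s + s ≈ 0#
      2s≉0 eq = s≉0 (+-nonneg-zeroˡ 0≤s 0≤s eq)

      t-upper : UpperBound P ((s + s) ⁻¹ * (s * s + x))
      t-upper y y²≤x = *-cancelˡ-≤ 0≤2s 2s≉0 (begin
        (s + s) * y                          ≤⟨ 2xy≤x²+y² s y ⟩
        s * s + y * y                        ≤⟨ +-monoʳ-≤ (s * s) y²≤x ⟩
        s * s + x                            ≈⟨ cancel-⁻¹ _ 2s≉0 ⟨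
        (s + s) * ((s + s) ⁻¹ * (s * s + x)) ∎)

    s≈0⇒x≤0 : s ≈ 0# → x ≤ 0#
    s≈0⇒x≤0 s≈0 with total x 1#
    ... | inj₁ x≤1 = ≤-trans (upper x Px) (≤-reflexive s≈0)
      where
      Px : x * x ≤ x
      Px = ≤-trans (*-monoˡ-≤ 0≤x x≤1) (≤-reflexive (*-identityʳ x))
    ... | inj₂ 1≤x = contradiction (antisym 0≤1 1≤0) 0≉1
      where
      1≤0 : 1# ≤ 0#
      1≤0 = ≤-trans (upper 1# (≤-trans (≤-reflexive (*-identityˡ 1#)) 1≤x)) (≤-reflexive s≈0)

    x≤s² : x ≤ s * s
    x≤s² with s ≟ 0#
    ... | yes s≈0 = ≤-trans (s≈0⇒x≤0 s≈0) (sq-nonneg s)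
    ... | no  s≉0 = +-cancelˡ-≤ x (*-cancelˡ-≤ 0≤s s≉0 (begin
      s * (x + x)          ≈⟨ cancel-⁻¹ _ q≉0 ⟨
      q * (q ⁻¹ * (s * (x + x))) ≤⟨ *-monoˡ-≤ 0≤q (upper t Pt) ⟩
      q * s                ≈⟨ solve 2 (λ s x → (s :* s :+ x) :* s := s :* (x :+ s :* s)) refl s x ⟩
      s * (x + s * s)      ∎))
      where
      q = s * s + x

      0≤q : 0# ≤ q
      0≤q = ≤-trans (sq-nonneg s) (m≤m+n 0≤x)

      q≉0 : ¬ q ≈ 0#
      q≉0 q≈0 = s≉0 (begin-equality
        s              ≈⟨ cancel-⁻¹ s s≉0 ⟨
        s * (s ⁻¹ * s) ≈⟨ solve 2 (λ s i → s :* (i :* s) := i :* (s :* s)) refl s (s ⁻¹) ⟩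
        s ⁻¹ * (s * s) ≈⟨ *-congˡ (+-nonneg-zeroˡ (sq-nonneg s) 0≤x q≈0) ⟩
        s ⁻¹ * 0#      ≈⟨ zeroʳ _ ⟩
        0#             ∎)

      i = q ⁻¹
      t = i * (s * (x + x))

      Pt : t * t ≤ x
      Pt = begin
        t * t                                    ≈⟨ solve 3 (λ i s x →
                                                      i :* (s :* (x :+ x)) :* (i :* (s :* (x :+ x))) :=
                                                      i :* i :* x :* ((s :* s :+ s :* s) :* (x :+ x)))
                                                      refl i s x ⟩
        i * i * x * ((s * s + s * s) * (x + x))  ≤⟨ *-monoˡ-≤ (*-nonneg (sq-nonneg i) 0≤x)
                                                      (4xy≤[x+y]² (s * s) x) ⟩
        i * i * x * (q * q)                      ≈⟨ solve 3 (λ i x q →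
                                                      i :* i :* x :* (q :* q) := q :* (i :* (q :* (i :* x))))
                                                      refl i x q ⟩
        q * (i * (q * (i * x)))                  ≈⟨ cancel-⁻¹ _ q≉0 ⟩
        q * (i * x)                              ≈⟨ cancel-⁻¹ x q≉0 ⟩
        x                                        ∎

  -- The junk value 0 is returned for negative arguments.
  √ : Carrier → Carrier
  √ x with 0# ≤? x
  ... | yes 0≤x = proj₁ (sqrt x 0≤x)
  ... | no  _   = 0#

record Graph (v : ℕ) : Set₁ where
  infix 4 _∼_ _∼?_
  field
    _∼_    : Rel (Fin v) 0ℓ
    _∼?_   : Decidable _∼_
    sym    : Symmetric _∼_
    irrefl : Irreflexive _≡_ _∼_

  neighbours : Fin v → Subset v
  neighbours x = tabulate λ y → does (x ∼? y)

  data Walk : ℕ → Fin v → Fin v → Set where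
    []  : ∀ {x} → Walk zero x x
    _∷_ : ∀ {n x y z} → x ∼ y → Walk n y z → Walk (suc n) x z

  Distance : ℕ → Fin v → Fin v → Set
  Distance d x y = Walk d x y × (∀ n → Walk n x y → d ℕ.≤ n)

  DiameterAtMost : ℕ → Set
  DiameterAtMost d = ∀ x y → ∃[ n ] n ℕ.≤ d × Distance n x y

  Complete : Set
  Complete = ∀ x y → x ≢ y → x ∼ y

  record IsEdgeRegular (k λ′ : ℕ) : Set where
    field
      valency         : ∀ x → ∣ neighbours x ∣ ≡ k
      adjacent-common : ∀ x y → x ∼ y → ∣ neighbours x ∩ neighbours y ∣ ≡ λ′

  record IsAmplyRegular (k λ′ μ : ℕ) : Set where
    field
      isEdgeRegular    : IsEdgeRegular k λ′
      distance2-common : ∀ x y → Distance 2 x y → ∣ neighbours x ∩ neighbours y ∣ ≡ μ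
    open IsEdgeRegular isEdgeRegular public

  -- In a complete graph no two vertices are at distance 2, so μ is arbitrary.
  record IsStronglyRegular (k λ′ μ : ℕ) : Set where
    field
      isAmplyRegular : IsAmplyRegular k λ′ μ
      diameter≤2     : DiameterAtMost 2
    open IsAmplyRegular isAmplyRegular public

  IsClique : Subset v → Set
  IsClique C = ∀ x y → x ∈ C → y ∈ C → x ≢ y → x ∼ y

module Spectrum (ℝ : RealNumbers) {v : ℕ} (Γ : Graph v) where
  open RealNumbers ℝ hiding (sym)
  open Graph Γ
  open Sum +-monoid using (sum)

  adjacencyMatrix : Fin v → Fin v → Carrier
  adjacencyMatrix x y = if does (x ∼? y) then 1# else 0#

  IsEigenvalue : Carrier → Set
  IsEigenvalue θ =
    Σ[ f ∈ (Fin v → Carrier) ]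
      ¬ (∀ x → f x ≈ 0#) × (∀ x → sum (λ y → adjacencyMatrix x y * f y) ≈ θ * f x)

  IsSmallestEigenvalue : Carrier → Set
  IsSmallestEigenvalue θ = IsEigenvalue θ × (∀ η → IsEigenvalue η → θ ≤ η)

  -- For a graph of valency k with smallest eigenvalue - m.
  IsDelsarteClique : ℕ → Carrier → Subset v → Set
  IsDelsarteClique k m C = IsClique C × fromℕ ∣ C ∣ ≈ 1# + fromℕ k / m

{-# OPTIONS --safe #-}
-- Write d = k / m and s = μ / m, so that the other restricted eigenvalue is d - s.  Then
-- A² = (d - s - m) A + m (d - s) I + μ J, and for every vector f this expresses
-- ‖(A - θ) f‖², θ ∈ {- m, d - s}, through the quadratic form of A - θ and the sum of f.
-- Equality in the Delsarte bound gives ‖(A - (d - s)) χ - s‖² = 0 for the characteristic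
-- vector χ of the clique C, so every vertex outside C has exactly s neighbours in C.
-- The projections of the vertices of C into the eigenspace of d - s are linearly independent,
-- so its dimension m (m - 1) d (d + 1) / (s (d + m - s)) is at least d + 1.  This is
-- obtained without any dimension theory: for a vertex x outside C, the squared distance in the
-- eigenspace from x to the span of C is a positive multiple of m (m - 1) d - s (d + m - s).
-- Hence μ (k + m² - μ) ≤ m² (m - 1) k ≤ m² (m - 1) (k + m²), i.e. Δ ≤ (2 μ - (k + m²))².
module Submission where

open import Defs
open import Algebra.Bundles using (CommutativeRing; RawRing)
import Algebra.Properties.AbelianGroup as AbelianGroupProperties
import Algebra.Properties.Ring as RingProperties
import Algebra.Properties.Semiring.Mult.TCOptimised as SemiringMult
import Algebra.Properties.Semiring.Sum as SemiringSum
import Algebra.Solver.Ring as RingSolver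
open import Algebra.Solver.Ring.AlmostCommutativeRing
  using (fromCommutativeRing; _-Raw-AlmostCommutative⟶_)
open import Data.Bool.Base using (Bool; true; false; if_then_else_; _∧_)
import Data.Bool.Properties as Bool
open import Data.Fin.Base using (Fin; zero; suc)
open import Data.Fin.Properties using (any?; ¬∀⟶∃¬) renaming (_≟_ to _≟ꟳ_)
open import Data.Fin.Subset using (Subset; ∣_∣; _∩_)
open import Data.Fin.Subset.Properties using (∩-idem)
open import Data.Integer.Base as ℤ using (ℤ; +_; -[1+_])
import Data.Integer.Properties as ℤ
open import Data.Maybe.Base using (map)
open import Data.Nat.Base as ℕ using (ℕ; zero; suc)
import Data.Nat.Properties as ℕ
open import Data.Product.Base using (∃; _×_; _,_; proj₁; proj₂)
open import Data.Sum.Base using (_⊎_; inj₁; inj₂)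
open import Data.Vec.Base using (lookup; []; _∷_)
open import Data.Vec.Properties using (lookup∘tabulate; lookup-zipWith; lookup⇒[]=)
open import Relation.Binary.Consequences using (dec⇒weaklyDec)
open import Relation.Binary.PropositionalEquality.Core as ≡ using (_≡_; _≢_)
import Relation.Binary.Reasoning.Setoid as SetoidReasoning
open import Relation.Nullary using (¬_; Dec; yes; no; contradiction)
open import Relation.Nullary.Decidable
  using (does; dec-true; dec-false; decidable-stable; ¬?; _×-dec_)

-- A ring solver with integer coefficients.

module IntegerCoefficients {c ℓ} (R : CommutativeRing c ℓ) where
  open CommutativeRing R
  open RingProperties ring using (-0#≈0#; -‿involutive; -‿distribˡ-*; -‿distribʳ-*)
  open AbelianGroupProperties +-abelianGroup using (⁻¹-∙-comm)
  open SemiringMult semiring using (×-homo-+; ×1-homo-*; 1+×) renaming (_×_ to _×′_)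
  open SetoidReasoning setoid

  -- With the optimised multiple `_×′_`, the images of 0 and 1 reduce to `0#` and `1#`, so the
  -- solver constants `:0` and `:1` match these literals by `refl`.
  fromℤ : ℤ → Carrier
  fromℤ (+ n)    = n ×′ 1#
  fromℤ -[1+ n ] = - (suc n ×′ 1#)

  -- Addition of integers of opposite sign is defined through `⊖`; this is the only case of
  -- `fromℤ-+` that needs an induction.
  fromℤ-⊖ : ∀ m n → fromℤ (m ℤ.⊖ n) ≈ m ×′ 1# - n ×′ 1#
  fromℤ-⊖ m       zero    = sym (trans (+-congˡ -0#≈0#) (+-identityʳ _))
  fromℤ-⊖ zero    (suc n) = sym (+-identityˡ _)
  fromℤ-⊖ (suc m) (suc n) = begin
    fromℤ (suc m ℤ.⊖ suc n)                 ≡⟨ ≡.cong fromℤ (ℤ.[1+m]⊖[1+n]≡m⊖n m n) ⟩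
    fromℤ (m ℤ.⊖ n)                         ≈⟨ fromℤ-⊖ m n ⟩
    m ×′ 1# - n ×′ 1#                       ≈⟨ +-congʳ (+-identityʳ _) ⟨
    -- A unit is inserted together with its negative: one joins the first multiple, the other the
    -- second.
    m ×′ 1# + 0# - n ×′ 1#                  ≈⟨ +-congʳ (+-congˡ (-‿inverseʳ 1#)) ⟨
    m ×′ 1# + (1# - 1#) - n ×′ 1#           ≈⟨ +-congʳ (+-assoc _ 1# (- 1#)) ⟨
    m ×′ 1# + 1# - 1# - n ×′ 1#             ≈⟨ +-assoc _ (- 1#) _ ⟩
    m ×′ 1# + 1# + (- 1# - n ×′ 1#)         ≈⟨ +-cong (+-comm _ 1#) (⁻¹-∙-comm 1# _) ⟩
    1# + m ×′ 1# - (1# + n ×′ 1#)           ≈⟨ +-cong (1+× m 1#) (-‿cong (1+× n 1#)) ⟨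
    suc m ×′ 1# - suc n ×′ 1#               ∎

  fromℤ-+ : ∀ i j → fromℤ (i ℤ.+ j) ≈ fromℤ i + fromℤ j
  fromℤ-+ (+ m)    (+ n)    = ×-homo-+ 1# m n
  fromℤ-+ (+ m)    -[1+ n ] = fromℤ-⊖ m (suc n)
  fromℤ-+ -[1+ m ] (+ n)    = trans (fromℤ-⊖ n (suc m)) (+-comm _ _)
  fromℤ-+ -[1+ m ] -[1+ n ] = begin
    - (suc (suc (m ℕ.+ n)) ×′ 1#)     ≡⟨ ≡.cong (λ j → - (suc j ×′ 1#)) (ℕ.+-suc m n) ⟨
    - ((suc m ℕ.+ suc n) ×′ 1#)       ≈⟨ -‿cong (×-homo-+ 1# (suc m) (suc n)) ⟩
    - (suc m ×′ 1# + suc n ×′ 1#)     ≈⟨ ⁻¹-∙-comm _ _ ⟨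
    - (suc m ×′ 1#) - suc n ×′ 1#     ∎

  fromℤ-neg : ∀ i → fromℤ (ℤ.- i) ≈ - fromℤ i
  fromℤ-neg (+ zero)  = sym -0#≈0#
  fromℤ-neg (+ suc n) = refl
  fromℤ-neg -[1+ n ]  = sym (-‿involutive _)

  fromℤ-pos-* : ∀ m j → fromℤ (+ m ℤ.* j) ≈ m ×′ 1# * fromℤ j
  fromℤ-pos-* m (+ n) = begin
    fromℤ (+ m ℤ.* + n)           ≡⟨ ≡.cong fromℤ (ℤ.pos-* m n) ⟨
    (m ℕ.* n) ×′ 1#               ≈⟨ ×1-homo-* m n ⟩
    m ×′ 1# * n ×′ 1#             ∎
  fromℤ-pos-* m -[1+ n ] = begin
    fromℤ (+ m ℤ.* -[1+ n ])      ≡⟨ ≡.cong fromℤ (ℤ.neg-distribʳ-* (+ m) (+ suc n)) ⟨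
    fromℤ (ℤ.- (+ m ℤ.* + suc n)) ≈⟨ fromℤ-neg (+ m ℤ.* + suc n) ⟩
    - fromℤ (+ m ℤ.* + suc n)     ≈⟨ -‿cong (fromℤ-pos-* m (+ suc n)) ⟩
    - (m ×′ 1# * suc n ×′ 1#)     ≈⟨ -‿distribʳ-* _ _ ⟩
    m ×′ 1# * - (suc n ×′ 1#)     ∎

  fromℤ-* : ∀ i j → fromℤ (i ℤ.* j) ≈ fromℤ i * fromℤ j
  fromℤ-* (+ m)    j = fromℤ-pos-* m j
  fromℤ-* -[1+ m ] j = begin
    fromℤ (-[1+ m ] ℤ.* j)        ≡⟨ ≡.cong fromℤ (ℤ.neg-distribˡ-* (+ suc m) j) ⟨
    fromℤ (ℤ.- (+ suc m ℤ.* j))   ≈⟨ fromℤ-neg (+ suc m ℤ.* j) ⟩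
    - fromℤ (+ suc m ℤ.* j)       ≈⟨ -‿cong (fromℤ-pos-* (suc m) j) ⟩
    - (suc m ×′ 1# * fromℤ j)     ≈⟨ -‿distribˡ-* _ _ ⟩
    - (suc m ×′ 1#) * fromℤ j     ∎

  ℤ-rawRing : RawRing _ _
  ℤ-rawRing = record
    { Carrier = ℤ ; _≈_ = _≡_ ; _+_ = ℤ._+_ ; _*_ = ℤ._*_
    ; -_ = ℤ.-_ ; 0# = ℤ.0ℤ ; 1# = ℤ.1ℤ }

  fromℤ-morphism : ℤ-rawRing -Raw-AlmostCommutative⟶ fromCommutativeRing R
  fromℤ-morphism = record
    { ⟦_⟧ = fromℤ ; +-homo = fromℤ-+ ; *-homo = fromℤ-* ; -‿homo = fromℤ-neg
    ; 0-homo = refl ; 1-homo = refl }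

  -- Coefficients are compared in ℤ, where equality is decided by computation, so cancelling terms
  -- are recognised during normalisation.
  open RingSolver ℤ-rawRing (fromCommutativeRing R) fromℤ-morphism
    (λ i j → map (λ i≡j → reflexive (≡.cong fromℤ i≡j)) (dec⇒weaklyDec ℤ._≟_ i j))
    public using (Polynomial; solve; con; _:+_; _:*_; _:-_; :-_; _:=_)

  :0 :1 : ∀ {n} → Polynomial n
  :0 = con ℤ.0ℤ
  :1 = con ℤ.1ℤ

-- Order, cancellation and square roots in the real field.

module OrderedField (ℝ : RealNumbers) where
  open RealNumbers ℝ
  open IntegerCoefficients commutativeRing using (solve; _:+_; _:*_; _:-_; :-_; _:=_; :0; :1)

  ≤-resp-≈ : ∀ {x x′ y y′} → x ≈ x′ → y ≈ y′ → x ≤ y → x′ ≤ y′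
  ≤-resp-≈ x≈x′ y≈y′ x≤y = ≤-trans (≤-reflexive (sym x≈x′)) (≤-trans x≤y (≤-reflexive y≈y′))

  0≤-resp-≈ : ∀ {x y} → x ≈ y → 0# ≤ x → 0# ≤ y
  0≤-resp-≈ = ≤-resp-≈ refl

  ≤⇒0≤- : ∀ {x y} → x ≤ y → 0# ≤ y - x
  ≤⇒0≤- {x} {y} x≤y = ≤-resp-≈ (-‿inverseˡ x) (+-comm (- x) y) (+-monoʳ-≤ (- x) x≤y)

  0≤-⇒≤ : ∀ {x y} → 0# ≤ y - x → x ≤ y
  0≤-⇒≤ {x} {y} 0≤y-x = ≤-resp-≈ (+-identityʳ x)
    (solve 2 (λ x y → x :+ (y :- x) := y) refl x y) (+-monoʳ-≤ x 0≤y-x)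

  0≤-neg : ∀ {x} → x ≤ 0# → 0# ≤ - x
  0≤-neg {x} x≤0 = 0≤-resp-≈ (+-identityˡ (- x)) (≤⇒0≤- x≤0)

  +-nonneg : ∀ {x y} → 0# ≤ x → 0# ≤ y → 0# ≤ x + y
  +-nonneg {x} {y} 0≤x 0≤y = ≤-trans 0≤x (≤-resp-≈ (+-identityʳ x) refl (+-monoʳ-≤ x 0≤y))

  sq-nonneg : ∀ x → 0# ≤ x * x
  sq-nonneg x with total 0# x
  ... | inj₁ 0≤x = *-nonneg 0≤x 0≤x
  ... | inj₂ x≤0 = 0≤-resp-≈ (solve 1 (λ x → :- x :* :- x := x :* x) refl x)
    (*-nonneg (0≤-neg x≤0) (0≤-neg x≤0))

  0≤1 : 0# ≤ 1#
  0≤1 = 0≤-resp-≈ (*-identityˡ 1#) (sq-nonneg 1#)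

  Positive : Carrier → Set
  Positive x = 0# ≤ x × ¬ x ≈ 0#

  Positive-resp-≈ : ∀ {x y} → x ≈ y → Positive x → Positive y
  Positive-resp-≈ x≈y (0≤x , x≉0) = 0≤-resp-≈ x≈y 0≤x , λ y≈0 → x≉0 (trans x≈y y≈0)

  ≰⇒Positive : ∀ {x} → ¬ x ≤ 0# → Positive x
  ≰⇒Positive {x} x≰0 with total 0# x
  ... | inj₁ 0≤x = 0≤x , λ x≈0 → x≰0 (≤-reflexive x≈0)
  ... | inj₂ x≤0 = contradiction x≤0 x≰0

  Positive⇒≰ : ∀ {x} → Positive x → ¬ x ≤ 0#
  Positive⇒≰ (0≤x , x≉0) x≤0 = x≉0 (antisym x≤0 0≤x)

  Positive-mono : ∀ {x y} → Positive x → x ≤ y → Positive y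
  Positive-mono x>0 x≤y = ≰⇒Positive λ y≤0 → Positive⇒≰ x>0 (≤-trans x≤y y≤0)

  1-positive : Positive 1#
  1-positive = 0≤1 , λ 1≈0 → 0≉1 (sym 1≈0)

  +-positiveˡ : ∀ {x y} → Positive x → 0# ≤ y → Positive (x + y)
  +-positiveˡ {x} x>0 0≤y = Positive-mono x>0 (≤-resp-≈ (+-identityʳ x) refl (+-monoʳ-≤ x 0≤y))

  *-cancelˡ : ∀ {c x y} → ¬ c ≈ 0# → c * x ≈ c * y → x ≈ y
  *-cancelˡ {c} {x} {y} c≉0 cx≈cy = trans (expand x) (trans (*-congˡ cx≈cy) (sym (expand y)))
    where
    expand : ∀ z → z ≈ c ⁻¹ * (c * z)
    expand z = trans (sym (*-identityˡ z)) (trans (*-congʳ (sym (*-inverseʳ c≉0)))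
      (solve 3 (λ c i z → c :* i :* z := i :* (c :* z)) refl c (c ⁻¹) z))

  *-≉0 : ∀ {x y} → ¬ x ≈ 0# → ¬ y ≈ 0# → ¬ x * y ≈ 0#
  *-≉0 x≉0 y≉0 xy≈0 = y≉0 (*-cancelˡ x≉0 (trans xy≈0 (sym (zeroʳ _))))

  *-positive : ∀ {x y} → Positive x → Positive y → Positive (x * y)
  *-positive (0≤x , x≉0) (0≤y , y≉0) = *-nonneg 0≤x 0≤y , *-≉0 x≉0 y≉0

  -- If `x ≤ 0#`, then `c * x` is squeezed to zero from both sides, and cancelling `c` gives
  -- `x ≈ 0#`.
  *-cancelˡ-nonneg : ∀ {c x} → Positive c → 0# ≤ c * x → 0# ≤ x
  *-cancelˡ-nonneg {c} {x} (0≤c , c≉0) 0≤cx with total 0# x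
  ... | inj₁ 0≤x = 0≤x
  ... | inj₂ x≤0 = ≤-reflexive (*-cancelˡ c≉0 (trans (zeroʳ c) (antisym 0≤cx cx≤0)))
    where
    cx≤0 : c * x ≤ 0#
    cx≤0 = 0≤-⇒≤ (0≤-resp-≈ (solve 2 (λ c x → c :* :- x := :0 :- c :* x) refl c x)
      (*-nonneg 0≤c (0≤-neg x≤0)))

  *-cancelˡ-positive : ∀ {c x} → Positive c → Positive (c * x) → Positive x
  *-cancelˡ-positive {c} c>0 (0≤cx , cx≉0) =
    *-cancelˡ-nonneg c>0 0≤cx , λ x≈0 → cx≉0 (trans (*-congˡ x≈0) (zeroʳ c))

  fromℕ-nonneg : ∀ n → 0# ≤ fromℕ n
  fromℕ-nonneg zero    = ≤-refl
  fromℕ-nonneg (suc n) = +-nonneg 0≤1 (fromℕ-nonneg n)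

  fromℕ-suc-positive : ∀ n → Positive (fromℕ (suc n))
  fromℕ-suc-positive n = +-positiveˡ 1-positive (fromℕ-nonneg n)

  -- When `y ≤ x`, the factor `x + y` of y² - x² is nonnegative and can be cancelled unless it
  -- vanishes; if it vanishes, `x ≤ x + y ≈ 0# ≤ y`.
  sq≤sq⇒≤ : ∀ {x y} → 0# ≤ y → x * x ≤ y * y → x ≤ y
  sq≤sq⇒≤ {x} {y} 0≤y x²≤y² with total x y
  ... | inj₁ x≤y = x≤y
  ... | inj₂ y≤x with x + y ≟ 0#
  ...   | yes x+y≈0 = ≤-trans (≤-resp-≈ (+-identityʳ x) x+y≈0
            (+-monoʳ-≤ x 0≤y)) 0≤y
  ...   | no  x+y≉0 = 0≤-⇒≤ (*-cancelˡ-nonneg (+-nonneg (≤-trans 0≤y y≤x) 0≤y , x+y≉0)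
            (0≤-resp-≈ (solve 2 (λ x y → y :* y :- x :* x := (x :+ y) :* (y :- x)) refl x y)
              (≤⇒0≤- x²≤y²)))

  √-nonneg : ∀ x → 0# ≤ √ x
  √-nonneg x with 0# ≤? x
  ... | yes 0≤x = proj₁ (proj₂ (sqrt x 0≤x))
  ... | no  _   = ≤-refl

  -- For negative `x` the default value 0 of `√` turns the claim into 0 ≤ y², so no sign condition
  -- on `x` is imposed.
  √²≤ : ∀ {x y} → x ≤ y * y → √ x * √ x ≤ y * y
  √²≤ {x} {y} x≤y² with 0# ≤? x
  ... | yes 0≤x = ≤-resp-≈ (sym (proj₂ (proj₂ (sqrt x 0≤x)))) refl x≤y²
  ... | no  _   = ≤-resp-≈ (sym (zeroˡ 0#)) refl (sq-nonneg y)

  2*[x/2] : ∀ x → fromℕ 2 * (x / fromℕ 2) ≈ x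
  2*[x/2] x = trans (solve 3 (λ t x i → t :* (x :* i) := x :* (t :* i)) refl (fromℕ 2) x (fromℕ 2 ⁻¹))
    (trans (*-congˡ (*-inverseʳ (proj₂ (fromℕ-suc-positive 1)))) (*-identityʳ x))

  x+x≤y⇒x≤y/2 : ∀ {x y} → x + x ≤ y → x ≤ y / fromℕ 2
  x+x≤y⇒x≤y/2 {x} {y} 2x≤y = 0≤-⇒≤ (*-cancelˡ-nonneg (fromℕ-suc-positive 1)
    (0≤-resp-≈ (trans (+-congʳ (sym (2*[x/2] y)))
      -- The numeral is spelled the way `fromℕ 2` unfolds.
      (solve 2 (λ h x → (:1 :+ (:1 :+ :0)) :* h :- (x :+ x)
           := (:1 :+ (:1 :+ :0)) :* (h :- x)) refl (y / fromℕ 2) x)) (≤⇒0≤- 2x≤y)))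

  y≤x+x⇒y/2≤x : ∀ {x y} → y ≤ x + x → y / fromℕ 2 ≤ x
  y≤x+x⇒y/2≤x {x} {y} y≤2x = 0≤-⇒≤ (*-cancelˡ-nonneg (fromℕ-suc-positive 1)
    (0≤-resp-≈ (trans (+-congˡ (-‿cong (sym (2*[x/2] y))))
      (solve 2 (λ h x → (x :+ x) :- (:1 :+ (:1 :+ :0)) :* h
           := (:1 :+ (:1 :+ :0)) :* (x :- h)) refl (y / fromℕ 2) x)) (≤⇒0≤- y≤2x)))

  -- The sign of `x + x - y` decides on which side of the midpoint y / 2 the number `x` lies; in
  -- either case its distance from the midpoint is at least t / 2.
  sq≤[2x-y]²⇒outside : ∀ {x y t} → 0# ≤ t → t * t ≤ (x + x - y) * (x + x - y) →
                       x ≤ (y - t) / fromℕ 2 ⊎ (y + t) / fromℕ 2 ≤ x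
  sq≤[2x-y]²⇒outside {x} {y} {t} 0≤t t²≤ with total 0# (x + x - y)
  ... | inj₁ 0≤2x-y = inj₂ (y≤x+x⇒y/2≤x (0≤-⇒≤ (0≤-resp-≈
    (solve 3 (λ x y t → x :+ x :- y :- t := x :+ x :- (y :+ t)) refl x y t)
    (≤⇒0≤- (sq≤sq⇒≤ 0≤2x-y t²≤)))))
  ... | inj₂ 2x-y≤0 = inj₁ (x+x≤y⇒x≤y/2 (0≤-⇒≤ (0≤-resp-≈
    (solve 3 (λ x y t → :- (x :+ x :- y) :- t := y :- t :- (x :+ x)) refl x y t)
    (≤⇒0≤- (sq≤sq⇒≤ (0≤-neg 2x-y≤0) (≤-resp-≈ refl
      (solve 1 (λ z → z :* z := (:- z) :* (:- z)) refl (x + x - y)) t²≤))))))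

-- Finite sums, indicators and the Kronecker delta.

module FiniteSums (ℝ : RealNumbers) where
  open RealNumbers ℝ hiding (zero)
  open IntegerCoefficients commutativeRing using (solve; _:+_; _:*_; _:-_; :-_; _:=_)
  open OrderedField ℝ
  open SemiringSum semiring public
    using (sum; sum-syntax; sum-cong-≋; ∑-distrib-+; ∑-comm; *-distribˡ-sum; *-distribʳ-sum; sum-replicate-zero)
  open SetoidReasoning setoid
  open RingProperties ring using (-‿distribˡ-*)

  private variable
    n : ℕ

  ∑-cong : {f g : Fin n → Carrier} → (∀ i → f i ≈ g i) → sum f ≈ sum g
  ∑-cong = sum-cong-≋

  ∑-linear : ∀ a b (f g : Fin n → Carrier) →
             ∑[ i < n ] (a * f i + b * g i) ≈ a * sum f + b * sum g
  ∑-linear a b f g = trans (∑-distrib-+ (λ i → a * f i) (λ i → b * g i))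
    (sym (+-cong (*-distribˡ-sum a f) (*-distribˡ-sum b g)))

  ∑-0 : ∀ {f : Fin n → Carrier} → (∀ i → f i ≈ 0#) → sum f ≈ 0#
  ∑-0 {n} f≈0 = trans (∑-cong f≈0) (sum-replicate-zero n)

  ∑-const : ∀ n x → ∑[ i < n ] x ≈ x * fromℕ n
  ∑-const zero    x = sym (zeroʳ x)
  ∑-const (suc n) x = trans (+-cong (sym (*-identityʳ x)) (∑-const n x)) (sym (distribˡ x 1# (fromℕ n)))

  ∑-nonneg : {f : Fin n → Carrier} → (∀ i → 0# ≤ f i) → 0# ≤ sum f
  ∑-nonneg {zero}  0≤f = ≤-refl
  ∑-nonneg {suc n} 0≤f = +-nonneg (0≤f zero) (∑-nonneg (λ i → 0≤f (suc i)))

  term≤∑ : {f : Fin n → Carrier} → (∀ i → 0# ≤ f i) → ∀ i → f i ≤ sum f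
  term≤∑ 0≤f zero    = ≤-resp-≈ (+-identityʳ _) refl
    (+-monoʳ-≤ _ (∑-nonneg (λ i → 0≤f (suc i))))
  term≤∑ {f = f} 0≤f (suc i) = ≤-trans (term≤∑ (λ i → 0≤f (suc i)) i)
    (≤-resp-≈ (+-identityʳ _) (+-comm _ (f zero)) (+-monoʳ-≤ _ (0≤f zero)))

  ∑sq≈0⇒≈0 : (f : Fin n → Carrier) → ∑[ i < n ] (f i * f i) ≈ 0# → ∀ i → f i ≈ 0#
  ∑sq≈0⇒≈0 f ∑≈0 i with f i ≟ 0#
  ... | yes fi≈0 = fi≈0
  ... | no  fi≉0 = contradiction (antisym fi²≤0 (sq-nonneg (f i))) (*-≉0 fi≉0 fi≉0)
    where
    fi²≤0 : f i * f i ≤ 0#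
    fi²≤0 = ≤-resp-≈ refl ∑≈0 (term≤∑ (λ j → sq-nonneg (f j)) i)

  -- Both vectors whose norms are computed later are shifted by a constant, to remove their
  -- component along the all-ones vector.
  ∑[f-τ]² : ∀ (f : Fin n → Carrier) τ →
            ∑[ i < n ] ((f i - τ) * (f i - τ)) ≈
            ∑[ i < n ] (f i * f i) - (τ + τ) * sum f + τ * τ * fromℕ n
  ∑[f-τ]² {n} f τ = begin
    ∑[ i < n ] ((f i - τ) * (f i - τ))
      ≈⟨ ∑-cong (λ i → solve 2 (λ x τ → (x :- τ) :* (x :- τ) :=
           (x :* x :+ (:- (τ :+ τ)) :* x) :+ τ :* τ) refl (f i) τ) ⟩
    ∑[ i < n ] ((f i * f i + - (τ + τ) * f i) + τ * τ)
      ≈⟨ ∑-distrib-+ {n} (λ i → f i * f i + - (τ + τ) * f i) (λ _ → τ * τ) ⟩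
    ∑[ i < n ] (f i * f i + - (τ + τ) * f i) + ∑[ i < n ] (τ * τ)
      ≈⟨ +-cong (∑-distrib-+ {n} (λ i → f i * f i) (λ i → - (τ + τ) * f i)) (∑-const n (τ * τ)) ⟩
    ∑[ i < n ] (f i * f i) + ∑[ i < n ] (- (τ + τ) * f i) + τ * τ * fromℕ n
      ≈⟨ +-congʳ (+-congˡ (trans (sym (*-distribˡ-sum _ f)) (sym (-‿distribˡ-* _ _)))) ⟩
    ∑[ i < n ] (f i * f i) - (τ + τ) * sum f + τ * τ * fromℕ n ∎

  -- This is the same conditional as in `adjacencyMatrix`, so matrix entries are indicators by
  -- definition.
  indicator : Bool → Carrier
  indicator b = if b then 1# else 0#

  indicator-∧ : ∀ a b → indicator (a ∧ b) ≈ indicator a * indicator b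
  indicator-∧ true  b = sym (*-identityˡ _)
  indicator-∧ false b = sym (zeroˡ _)

  indicator-idem : ∀ b → indicator b * indicator b ≈ indicator b
  indicator-idem true  = *-identityˡ 1#
  indicator-idem false = zeroˡ 0#

  indicator-nonneg : ∀ b → 0# ≤ indicator b
  indicator-nonneg true  = 0≤1
  indicator-nonneg false = ≤-refl

  indicator≤1 : ∀ b → 0# ≤ 1# - indicator b
  indicator≤1 true  = ≤-reflexive (sym (-‿inverseʳ 1#))
  indicator≤1 false = ≤⇒0≤- 0≤1

  ∑-indicator : (S : Subset n) → ∑[ i < n ] indicator (lookup S i) ≈ fromℕ ∣ S ∣
  ∑-indicator []          = refl
  ∑-indicator (true  ∷ S) = +-congˡ (∑-indicator S)
  ∑-indicator (false ∷ S) = trans (+-identityˡ _) (∑-indicator S)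

  δ : Fin n → Fin n → Carrier
  δ i j = indicator (does (i ≟ꟳ j))

  δ-diag : (i : Fin n) → δ i i ≈ 1#
  δ-diag i = reflexive (≡.cong indicator (dec-true (i ≟ꟳ i) ≡.refl))

  δ-off : {i j : Fin n} → i ≢ j → δ i j ≈ 0#
  δ-off {i = i} {j} i≢j = reflexive (≡.cong indicator (dec-false (i ≟ꟳ j) i≢j))

  ∑-δ : (i : Fin n) (f : Fin n → Carrier) → ∑[ j < n ] (δ i j * f j) ≈ f i
  ∑-δ zero    f = trans (+-cong (*-identityˡ _) (∑-0 (λ j → zeroˡ (f (suc j))))) (+-identityʳ _)
  ∑-δ (suc i) f = trans (+-cong (zeroˡ _) (∑-δ i (λ j → f (suc j)))) (+-identityˡ _)

  ∑δ≈1 : (i : Fin n) → sum (δ i) ≈ 1#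
  ∑δ≈1 i = trans (∑-cong (λ j → sym (*-identityʳ (δ i j)))) (∑-δ i (λ _ → 1#))

-- Entries of the adjacency matrix and of its square.

module StronglyRegular
  (ℝ : RealNumbers) {v k λ′ μ : ℕ} (Γ : Graph v)
  (stronglyRegular : Graph.IsStronglyRegular Γ k λ′ μ)
  (¬complete : ¬ Graph.Complete Γ)
  where

  open RealNumbers ℝ hiding (zero)
  open Graph Γ renaming (sym to ∼-sym; irrefl to ∼-irrefl)
  open IsStronglyRegular stronglyRegular
  open Spectrum ℝ Γ renaming (adjacencyMatrix to A)
  open IntegerCoefficients commutativeRing
    using (solve; _:+_; _:*_; _:-_; :-_; _:=_; :0; :1)
  open OrderedField ℝ
  open FiniteSums ℝ
  open SetoidReasoning setoid

  K Λ M V : Carrier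
  K = fromℕ k
  Λ = fromℕ λ′
  M = fromℕ μ
  V = fromℕ v

  A-adj : ∀ {x y} → x ∼ y → A x y ≈ 1#
  A-adj {x} {y} x∼y = reflexive (≡.cong indicator (dec-true (x ∼? y) x∼y))

  A-nonadj : ∀ {x y} → ¬ x ∼ y → A x y ≈ 0#
  A-nonadj {x} {y} x≁y = reflexive (≡.cong indicator (dec-false (x ∼? y) x≁y))

  A-diag : ∀ x → A x x ≈ 0#
  A-diag x = A-nonadj (∼-irrefl ≡.refl)

  A-sym : ∀ x y → A x y ≈ A y x
  A-sym x y with x ∼? y
  ... | yes x∼y = sym (A-adj (∼-sym x∼y))
  ... | no  x≁y = sym (A-nonadj (λ y∼x → x≁y (∼-sym y∼x)))

  A-neighbours : ∀ x y → A x y ≡ indicator (lookup (neighbours x) y)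
  A-neighbours x y = ≡.sym (≡.cong indicator (lookup∘tabulate _ y))

  A-row : ∀ x → sum (A x) ≈ K
  A-row x = begin
    sum (A x)                                       ≈⟨ ∑-cong (λ y → reflexive (A-neighbours x y)) ⟩
    ∑[ y < v ] indicator (lookup (neighbours x) y)  ≈⟨ ∑-indicator (neighbours x) ⟩
    fromℕ ∣ neighbours x ∣                          ≡⟨ ≡.cong fromℕ (valency x) ⟩
    K                                               ∎

  A-common : ∀ x y → ∑[ z < v ] (A x z * A y z) ≈ fromℕ ∣ neighbours x ∩ neighbours y ∣
  A-common x y = trans (∑-cong step) (∑-indicator (neighbours x ∩ neighbours y))
    where
    step : ∀ z → A x z * A y z ≈ indicator (lookup (neighbours x ∩ neighbours y) z)
    step z = begin
      A x z * A y z
        ≡⟨ ≡.cong₂ _*_ (A-neighbours x z) (A-neighbours y z) ⟩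
      indicator (lookup (neighbours x) z) * indicator (lookup (neighbours y) z)
        ≈⟨ indicator-∧ (lookup (neighbours x) z) _ ⟨
      indicator (lookup (neighbours x) z ∧ lookup (neighbours y) z)
        ≡⟨ ≡.cong indicator (lookup-zipWith _∧_ z (neighbours x) (neighbours y)) ⟨
      indicator (lookup (neighbours x ∩ neighbours y) z) ∎

  distance2 : ∀ {x y} → x ≢ y → ¬ x ∼ y → Distance 2 x y
  distance2 {x} {y} x≢y x≁y with diameter≤2 x y
  ... | 0 , _ , [] , _                                     = contradiction ≡.refl x≢y
  ... | 1 , _ , (x∼y ∷ []) , _                             = contradiction x∼y x≁y
  ... | 2 , _ , dist                                       = dist
  ... | suc (suc (suc _)) , ℕ.s≤s (ℕ.s≤s ()) , _

  -- Counting common neighbours at distances 0, 1 and 2 gives A² = (λ - μ) A + (k - μ) I + μ J. The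
  -- factor `A y z` stands for `A z y`, so that each summand is the indicator of a common neighbour.
  A²-entry : ∀ x y → ∑[ z < v ] (A x z * A y z) ≈ ((Λ - M) * A x y + (K - M) * δ x y) + M
  A²-entry x y = trans (A-common x y) (entry (x ≟ꟳ y) (x ∼? y))
    where
    off-diagonal : ∀ {a} n → a ≈ A x y → x ≢ y →
      fromℕ n ≈ ((Λ - M) * a + (K - M) * 0#) + M →
      fromℕ n ≈ ((Λ - M) * A x y + (K - M) * δ x y) + M
    off-diagonal n a≈A x≢y eq =
      trans eq (+-congʳ (+-cong (*-congˡ a≈A) (*-congˡ (sym (δ-off x≢y)))))

    entry : Dec (x ≡ y) → Dec (x ∼ y) →
      fromℕ ∣ neighbours x ∩ neighbours y ∣ ≈ ((Λ - M) * A x y + (K - M) * δ x y) + M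
    entry (yes ≡.refl) _ = begin
      fromℕ ∣ neighbours x ∩ neighbours x ∣       ≡⟨ ≡.cong (λ S → fromℕ ∣ S ∣) (∩-idem (neighbours x)) ⟩
      fromℕ ∣ neighbours x ∣                      ≡⟨ ≡.cong fromℕ (valency x) ⟩
      K
        ≈⟨ solve 3 (λ k l m → k := (l :- m) :* :0 :+ (k :- m) :* :1 :+ m) refl K Λ M ⟩
      ((Λ - M) * 0# + (K - M) * 1#) + M
        ≈⟨ +-congʳ (+-cong (*-congˡ (A-diag x)) (*-congˡ (δ-diag x))) ⟨
      ((Λ - M) * A x x + (K - M) * δ x x) + M     ∎
    entry (no x≢y) (yes x∼y) = off-diagonal ∣ neighbours x ∩ neighbours y ∣ (sym (A-adj x∼y)) x≢y
      (trans (reflexive (≡.cong fromℕ (adjacent-common x y x∼y)))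
        (solve 3 (λ k l m → l := (l :- m) :* :1 :+ (k :- m) :* :0 :+ m) refl K Λ M))
    entry (no x≢y) (no x≁y) = off-diagonal ∣ neighbours x ∩ neighbours y ∣ (sym (A-nonadj x≁y)) x≢y
      (trans (reflexive (≡.cong fromℕ (distance2-common x y (distance2 x≢y x≁y))))
        (solve 3 (λ k l m → m := (l :- m) :* :0 :+ (k :- m) :* :0 :+ m) refl K Λ M))

  -- The adjacency operator and its quadratic relation.

  A∙ : (Fin v → Carrier) → Fin v → Carrier
  A∙ f x = ∑[ y < v ] (A x y * f y)

  A∙-cong : ∀ {f g} → (∀ x → f x ≈ g x) → ∀ x → A∙ f x ≈ A∙ g x
  A∙-cong f≈g x = ∑-cong (λ y → *-congˡ (f≈g y))

  A∙-linear : ∀ a b f g x → A∙ (λ y → a * f y + b * g y) x ≈ a * A∙ f x + b * A∙ g x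
  A∙-linear a b f g x = trans
    (∑-cong (λ y → solve 5 (λ p a b f g → p :* (a :* f :+ b :* g) := a :* (p :* f) :+ b :* (p :* g))
      refl (A x y) a b (f y) (g y)))
    (∑-linear a b (λ y → A x y * f y) (λ y → A x y * g y))

  A∙δ : ∀ x y → A∙ (δ x) y ≈ A y x
  A∙δ x y = trans (∑-cong (λ z → *-comm (A y z) (δ x z))) (∑-δ x (A y))

  A∙-const : ∀ a x → A∙ (λ _ → a) x ≈ K * a
  A∙-const a x = trans (sym (*-distribʳ-sum a (A x))) (*-congʳ (A-row x))

  A∙-selfAdjoint : ∀ f g → ∑[ x < v ] (A∙ f x * g x) ≈ ∑[ x < v ] (f x * A∙ g x)
  A∙-selfAdjoint f g = begin
    ∑[ x < v ] (A∙ f x * g x)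
      ≈⟨ ∑-cong (λ x → *-distribʳ-sum (g x) (λ y → A x y * f y)) ⟩
    ∑[ x < v ] ∑[ y < v ] (A x y * f y * g x)
      ≈⟨ ∑-comm (λ x y → A x y * f y * g x) ⟩
    ∑[ y < v ] ∑[ x < v ] (A x y * f y * g x)
      ≈⟨ ∑-cong (λ y → trans (∑-cong (λ x → trans (*-congʳ (*-congʳ (A-sym x y)))
           (solve 3 (λ a f g → a :* f :* g := f :* (a :* g)) refl (A y x) (f y) (g x))))
           (sym (*-distribˡ-sum (f y) (λ x → A y x * g x)))) ⟩
    ∑[ y < v ] (f y * A∙ g y) ∎

  -- Self-adjointness moves the operator onto the all-ones vector, which is an eigenvector for `K`.
  ∑-A∙ : ∀ f → sum (A∙ f) ≈ K * sum f
  ∑-A∙ f = begin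
    sum (A∙ f)                          ≈⟨ ∑-cong (λ x → sym (*-identityʳ (A∙ f x))) ⟩
    ∑[ x < v ] (A∙ f x * 1#)            ≈⟨ A∙-selfAdjoint f (λ _ → 1#) ⟩
    ∑[ x < v ] (f x * A∙ (λ _ → 1#) x)
      ≈⟨ ∑-cong (λ x → trans (*-congˡ (trans (A∙-const 1# x) (*-identityʳ K))) (*-comm (f x) K)) ⟩
    ∑[ x < v ] (K * f x)                ≈⟨ *-distribˡ-sum K f ⟨
    K * sum f                           ∎

  A∙² : ∀ f x → A∙ (A∙ f) x ≈ ((Λ - M) * A∙ f x + (K - M) * f x) + M * sum f
  A∙² f x = begin
    ∑[ y < v ] (A x y * ∑[ z < v ] (A y z * f z))
      ≈⟨ ∑-cong (λ y → *-distribˡ-sum (A x y) (λ z → A y z * f z)) ⟩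
    ∑[ y < v ] ∑[ z < v ] (A x y * (A y z * f z))
      ≈⟨ ∑-comm (λ y z → A x y * (A y z * f z)) ⟩
    ∑[ z < v ] ∑[ y < v ] (A x y * (A y z * f z))
      ≈⟨ ∑-cong (λ z → ∑-cong (λ y → trans (*-congˡ (*-congʳ (A-sym y z))) (sym (*-assoc _ _ _)))) ⟩
    ∑[ z < v ] ∑[ y < v ] (A x y * A z y * f z)
      ≈⟨ ∑-cong (λ z → sym (*-distribʳ-sum (f z) (λ y → A x y * A z y))) ⟩
    ∑[ z < v ] (∑[ y < v ] (A x y * A z y) * f z)
      ≈⟨ ∑-cong (λ z → trans (*-congʳ (A²-entry x z))
           (solve 6 (λ a b m p d f → (a :* p :+ b :* d :+ m) :* f
                := a :* (p :* f) :+ b :* (d :* f) :+ m :* f)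
             refl (Λ - M) (K - M) M (A x z) (δ x z) (f z))) ⟩
    ∑[ z < v ] (((Λ - M) * (A x z * f z) + (K - M) * (δ x z * f z)) + M * f z)
      ≈⟨ ∑-distrib-+ {v} (λ z → (Λ - M) * (A x z * f z) + (K - M) * (δ x z * f z)) (λ z → M * f z) ⟩
    ∑[ z < v ] ((Λ - M) * (A x z * f z) + (K - M) * (δ x z * f z)) + ∑[ z < v ] (M * f z)
      ≈⟨ +-cong (∑-linear (Λ - M) (K - M) (λ z → A x z * f z) (λ z → δ x z * f z))
                (sym (*-distribˡ-sum M f)) ⟩
    ((Λ - M) * A∙ f x + (K - M) * ∑[ z < v ] (δ x z * f z)) + M * sum f
      ≈⟨ +-congʳ (+-congˡ (*-congˡ (∑-δ x f))) ⟩
    ((Λ - M) * A∙ f x + (K - M) * f x) + M * sum f ∎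

  -- By Vieta, these are the two roots of X² - (Λ - M) X - (K - M), a polynomial that annihilates A
  -- on the vectors of sum zero.
  RootPair : Carrier → Carrier → Set
  RootPair θ θ′ = (Λ - M ≈ θ + θ′) × (K - M ≈ - (θ * θ′))

  A-_∙ : Carrier → (Fin v → Carrier) → Fin v → Carrier
  (A- θ ∙) f x = A∙ f x + - θ * f x

  -- The quadratic relation factors as (A - θ′)(A - θ) = μ J.
  A∙-root : ∀ {θ θ′} → RootPair θ θ′ → ∀ f x →
            A∙ ((A- θ ∙) f) x ≈ θ′ * (A- θ ∙) f x + M * sum f
  A∙-root {θ} {θ′} (sum≈ , product≈) f x = begin
    A∙ ((A- θ ∙) f) x
      ≈⟨ A∙-cong (λ y → +-congʳ (sym (*-identityˡ (A∙ f y)))) x ⟩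
    A∙ (λ y → 1# * A∙ f y + - θ * f y) x
      ≈⟨ A∙-linear 1# (- θ) (A∙ f) f x ⟩
    1# * A∙ (A∙ f) x + - θ * A∙ f x
      ≈⟨ +-congʳ (*-congˡ (A∙² f x)) ⟩
    1# * (((Λ - M) * A∙ f x + (K - M) * f x) + M * sum f) + - θ * A∙ f x
      ≈⟨ +-congʳ (*-congˡ (+-congʳ (+-cong (*-congʳ sum≈) (*-congʳ product≈)))) ⟩
    1# * (((θ + θ′) * A∙ f x + - (θ * θ′) * f x) + M * sum f) + - θ * A∙ f x
      ≈⟨ solve 5 (λ t t′ a f s → :1 :* ((t :+ t′) :* a :+ (:- (t :* t′)) :* f :+ s) :+ (:- t) :* a
           := t′ :* (a :+ (:- t) :* f) :+ s) refl θ θ′ (A∙ f x) (f x) (M * sum f) ⟩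
    θ′ * (A- θ ∙) f x + M * sum f ∎

  -- As A - θ is self-adjoint, the left side is ⟨f, (A - θ)² f⟩, and `A∙-root` gives (A - θ)² = (θ′
  -- - θ)(A - θ) + μ J.
  ∑[A-θ]² : ∀ {θ θ′} → RootPair θ θ′ → ∀ f →
    ∑[ x < v ] ((A- θ ∙) f x * (A- θ ∙) f x) ≈
    (θ′ - θ) * ∑[ x < v ] (f x * (A- θ ∙) f x) + M * (sum f * sum f)
  ∑[A-θ]² {θ} {θ′} roots f = begin
    ∑[ x < v ] (w x * w x)
      ≈⟨ ∑-cong (λ x → solve 4 (λ a t f w → (a :+ (:- t) :* f) :* w := :1 :* (a :* w) :+ (:- t) :* (f :* w))
           refl (A∙ f x) θ (f x) (w x)) ⟩
    ∑[ x < v ] (1# * (A∙ f x * w x) + - θ * (f x * w x))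
      ≈⟨ ∑-linear 1# (- θ) (λ x → A∙ f x * w x) (λ x → f x * w x) ⟩
    1# * ∑[ x < v ] (A∙ f x * w x) + - θ * fw
      ≈⟨ +-congʳ (*-congˡ (trans (A∙-selfAdjoint f w) (∑-cong (λ x → *-congˡ (A∙-root roots f x))))) ⟩
    1# * ∑[ x < v ] (f x * (θ′ * w x + M * sum f)) + - θ * fw
      ≈⟨ +-congʳ (*-congˡ (∑-cong (λ x → solve 4 (λ f t w s → f :* (t :* w :+ s) := t :* (f :* w) :+ s :* f)
           refl (f x) θ′ (w x) (M * sum f)))) ⟩
    1# * ∑[ x < v ] (θ′ * (f x * w x) + M * sum f * f x) + - θ * fw
      ≈⟨ +-congʳ (*-congˡ (∑-linear θ′ (M * sum f) (λ x → f x * w x) f)) ⟩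
    1# * (θ′ * fw + M * sum f * sum f) + - θ * fw
      ≈⟨ solve 5 (λ t t′ q m s → :1 :* (t′ :* q :+ m :* s :* s) :+ (:- t) :* q
           := (t′ :- t) :* q :+ m :* (s :* s)) refl θ θ′ fw M (sum f) ⟩
    (θ′ - θ) * fw + M * (sum f * sum f) ∎
    where
    w = (A- θ ∙) f
    fw = ∑[ x < v ] (f x * w x)

  -- Signs of the parameters, by counting common and non-common neighbours.

  A-exclusive : ∀ x y {n} → ∑[ z < v ] (A x z * A y z) ≈ n →
                ∑[ z < v ] (A x z * (1# - A y z)) ≈ K - n
  A-exclusive x y {n} common = begin
    ∑[ z < v ] (A x z * (1# - A y z))
      ≈⟨ ∑-cong (λ z → solve 2 (λ a b → a :* (:1 :- b)
           := :1 :* a :+ (:- :1) :* (a :* b)) refl (A x z) (A y z)) ⟩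
    ∑[ z < v ] (1# * A x z + - 1# * (A x z * A y z))
      ≈⟨ ∑-linear 1# (- 1#) (A x) (λ z → A x z * A y z) ⟩
    1# * sum (A x) + - 1# * ∑[ z < v ] (A x z * A y z)
      ≈⟨ +-cong (*-congˡ (A-row x)) (*-congˡ common) ⟩
    1# * K + - 1# * n
      ≈⟨ solve 2 (λ k n → :1 :* k :+ (:- :1) :* n := k :- n) refl K n ⟩
    K - n ∎

  A-exclusive-nonneg : ∀ x y z → 0# ≤ A x z * (1# - A y z)
  A-exclusive-nonneg x y z = *-nonneg (indicator-nonneg (does (x ∼? z))) (indicator≤1 (does (y ∼? z)))

  nonadjacent : ∃ λ x → ∃ λ y → x ≢ y × ¬ x ∼ y
  nonadjacent with any? (λ x → any? (λ y → ¬? (x ≟ꟳ y) ×-dec ¬? (x ∼? y)))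
  ... | yes pair = pair
  ... | no ¬pair = contradiction
    (λ x y x≢y → decidable-stable (x ∼? y) (λ x≁y → ¬pair (x , y , x≢y , x≁y))) ¬complete

  -- An induced path of length two supplies an edge as well as a nonadjacent pair with a common
  -- neighbour, which is all that the sign conditions need.
  path : ∃ λ x → ∃ λ w → ∃ λ y → x ∼ w × y ∼ w × x ≢ y × ¬ x ∼ y
  path with nonadjacent
  ... | x , y , x≢y , x≁y with proj₁ (distance2 x≢y x≁y)
  ...   | x∼w ∷ (w∼y ∷ []) = x , _ , y , x∼w , ∼-sym w∼y , x≢y , x≁y

  M-positive : Positive M
  M-positive with path
  ... | x , w , y , x∼w , y∼w , x≢y , x≁y = Positive-mono 1-positive
    (≤-resp-≈ (trans (*-cong (A-adj x∼w) (A-adj y∼w)) (*-identityˡ 1#))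
      (trans (A-common x y) (reflexive (≡.cong fromℕ (distance2-common x y (distance2 x≢y x≁y)))))
      (term≤∑ (λ z → *-nonneg (indicator-nonneg (does (x ∼? z))) (indicator-nonneg (does (y ∼? z)))) w))

  0≤K-M : 0# ≤ K - M
  0≤K-M with path
  ... | x , w , y , x∼w , y∼w , x≢y , x≁y = 0≤-resp-≈
    (A-exclusive x y (trans (A-common x y) (reflexive (≡.cong fromℕ (distance2-common x y (distance2 x≢y x≁y))))))
    (∑-nonneg (A-exclusive-nonneg x y))

  K-positive : Positive K
  K-positive = Positive-resp-≈ (solve 2 (λ k m → m :+ (k :- m) := k) refl K M)
    (+-positiveˡ M-positive 0≤K-M)

  -- For an edge from `x` to `y`, the vertex `y` itself is a neighbour of `x` that is not adjacent
  -- to `y`.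
  K-Λ-positive : Positive (K - Λ)
  K-Λ-positive with path
  ... | x , y , _ , x∼y , _ = Positive-mono 1-positive
    (≤-resp-≈ (trans (*-cong (A-adj x∼y) (+-congˡ (-‿cong (A-diag y))))
        (solve 0 (:1 :* (:1 :- :0) := :1) refl))
      (A-exclusive x y (trans (A-common x y) (reflexive (≡.cong fromℕ (adjacent-common x y x∼y)))))
      (term≤∑ (A-exclusive-nonneg x y) y))

  -- (A - θ)(e_x - e_y) is an eigenvector for θ′, since A² - (θ + θ′) A + θ θ′ = M J.
  -- For adjacent x and y its entry at x is -1 - θ.
  root⇒eigenvalue : ∀ {θ θ′} → RootPair θ θ′ → 0# ≤ θ → IsEigenvalue θ′
  root⇒eigenvalue {θ} {θ′} roots 0≤θ with path
  ... | x , y , _ , x∼y , _ = (A- θ ∙) g , nonzero , eigen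
    where
    g : Fin v → Carrier
    g z = 1# * δ x z + - 1# * δ y z

    ∑g≈0 : sum g ≈ 0#
    ∑g≈0 = trans (∑-linear 1# (- 1#) (δ x) (δ y))
      (trans (+-cong (*-congˡ (∑δ≈1 x)) (*-congˡ (∑δ≈1 y)))
        (solve 0 (:1 :* :1 :+ (:- :1) :* :1 := :0) refl))

    eigen : ∀ z → A∙ ((A- θ ∙) g) z ≈ θ′ * (A- θ ∙) g z
    eigen z = trans (A∙-root roots g z)
      (trans (+-congˡ (trans (*-congˡ ∑g≈0) (zeroʳ M))) (+-identityʳ _))

    y≢x : y ≢ x
    y≢x y≡x = ∼-irrefl (≡.sym y≡x) x∼y

    entry : (A- θ ∙) g x ≈ - (1# + θ)
    entry = begin
      A∙ g x + - θ * g x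
        ≈⟨ +-congʳ (trans (A∙-linear 1# (- 1#) (δ x) (δ y) x) (+-cong (*-congˡ (A∙δ x x))
             (*-congˡ (A∙δ y x)))) ⟩
      (1# * A x x + - 1# * A x y) + - θ * g x
        ≈⟨ +-cong (+-cong (*-congˡ (A-diag x)) (*-congˡ (A-adj x∼y)))
                  (*-congˡ (+-cong (*-congˡ (δ-diag x)) (*-congˡ (δ-off y≢x)))) ⟩
      (1# * 0# + - 1# * 1#) + - θ * (1# * 1# + - 1# * 0#)
        ≈⟨ solve 1 (λ t → (:1 :* :0 :+ (:- :1) :* :1) :+ (:- t) :* (:1 :* :1 :+ (:- :1) :* :0)
             := :- (:1 :+ t)) refl θ ⟩
      - (1# + θ) ∎

    nonzero : ¬ (∀ z → (A- θ ∙) g z ≈ 0#)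
    nonzero all≈0 = proj₂ (+-positiveˡ 1-positive 0≤θ) (begin
      1# + θ          ≈⟨ solve 1 (λ t → :1 :+ t := :- (:- (:1 :+ t))) refl θ ⟩
      - - (1# + θ)    ≈⟨ -‿cong (trans (sym entry) (all≈0 x)) ⟩
      - 0#            ≈⟨ solve 0 (:- :0 := :0) refl ⟩
      0#              ∎)

  -- The quadratic formula yields a `RootPair`; since `K - M` is nonnegative, θ₁ ≥ 0 ≥ θ₂, and
  -- `root⇒eigenvalue` applied with θ₁ makes θ₂ an eigenvalue. Comparison with it shows that `m` is
  -- positive.
  negativeEigenvalue : ∃ λ θ → Positive (- θ) × IsEigenvalue θ
  negativeEigenvalue = θ₂ , -θ₂>0 , root⇒eigenvalue roots 0≤θ₁
    where
    a b 2# h t θ₁ θ₂ : Carrier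
    a  = Λ - M
    b  = K - M
    2# = 1# + 1#
    h  = 2# ⁻¹

    2-positive : Positive 2#
    2-positive = +-positiveˡ 1-positive 0≤1

    0≤4b : 0# ≤ 2# * 2# * b
    0≤4b = *-nonneg (sq-nonneg 2#) 0≤K-M

    root = sqrt (a * a + 2# * 2# * b) (+-nonneg (sq-nonneg a) 0≤4b)
    t  = proj₁ root
    0≤t = proj₁ (proj₂ root)
    t²≈ = proj₂ (proj₂ root)
    θ₁ = (a + t) * h
    θ₂ = (a - t) * h

    2h≈1 : 2# * h ≈ 1#
    2h≈1 = *-inverseʳ (proj₂ 2-positive)

    a²≤t² : a * a ≤ t * t
    a²≤t² = ≤-resp-≈ (+-identityʳ _) (sym t²≈) (+-monoʳ-≤ (a * a) 0≤4b)

    0≤h : 0# ≤ h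
    0≤h = *-cancelˡ-nonneg 2-positive (0≤-resp-≈ (sym 2h≈1) 0≤1)

    0≤θ₁ : 0# ≤ θ₁
    0≤θ₁ = *-nonneg (0≤-resp-≈ (solve 2 (λ a t → t :- (:- a) := a :+ t) refl a t)
      (≤⇒0≤- (sq≤sq⇒≤ 0≤t (≤-resp-≈ (solve 1 (λ a → a :* a := (:- a) :* (:- a)) refl a) refl a²≤t²)))) 0≤h

    0≤-θ₂ : 0# ≤ - θ₂
    0≤-θ₂ = 0≤-resp-≈ (solve 3 (λ a t h → (t :- a) :* h := :- ((a :- t) :* h)) refl a t h)
      (*-nonneg (≤⇒0≤- (sq≤sq⇒≤ 0≤t a²≤t²)) 0≤h)

    sum≈ : a ≈ θ₁ + θ₂
    sum≈ = begin
      a                          ≈⟨ *-identityʳ a ⟨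
      a * 1#                     ≈⟨ *-congˡ 2h≈1 ⟨
      a * ((1# + 1#) * h)
        ≈⟨ solve 3 (λ a t h → a :* ((:1 :+ :1) :* h) := (a :+ t) :* h :+ (a :- t) :* h) refl a t h ⟩
      θ₁ + θ₂                    ∎

    product≈ : b ≈ - (θ₁ * θ₂)
    product≈ = begin
      b
        ≈⟨ solve 1 (λ b → b := :1 :* :1 :* b) refl b ⟩
      1# * 1# * b
        ≈⟨ *-congʳ (*-cong 2h≈1 2h≈1) ⟨
      (1# + 1#) * h * ((1# + 1#) * h) * b
        ≈⟨ solve 3 (λ a b h → (:1 :+ :1) :* h :* ((:1 :+ :1) :* h) :* b
             := (a :* a :+ (:1 :+ :1) :* (:1 :+ :1) :* b :- a :* a) :* (h :* h)) refl a b h ⟩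
      (a * a + 2# * 2# * b - a * a) * (h * h)
        ≈⟨ *-congʳ (+-congʳ t²≈) ⟨
      (t * t - a * a) * (h * h)
        ≈⟨ solve 3 (λ a t h → (t :* t :- a :* a) :* (h :* h)
             := :- ((a :+ t) :* h :* ((a :- t) :* h))) refl a t h ⟩
      - (θ₁ * θ₂) ∎

    roots : RootPair θ₁ θ₂
    roots = sum≈ , product≈

    -- If θ₂ = 0, then K = M and θ₁ = Λ - K < 0.
    -θ₂>0 : Positive (- θ₂)
    -θ₂>0 = 0≤-θ₂ , λ -θ₂≈0 → Positive⇒≰ K-Λ-positive (0≤-⇒≤ (0≤-resp-≈ (begin
      θ₁
        ≈⟨ solve 2 (λ x y → x := x :+ y :+ (:- y) :+ (x :* (:- y) :- x :* (:- y))) refl θ₁ θ₂ ⟩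
      θ₁ + θ₂ + - θ₂ + (θ₁ * - θ₂ - θ₁ * - θ₂)
        ≈⟨ +-cong (+-cong (sym sum≈) -θ₂≈0) (+-cong (*-congˡ -θ₂≈0) (-‿cong (trans
             (solve 2 (λ x y → x :* (:- y) := :- (x :* y)) refl θ₁ θ₂) (sym product≈)))) ⟩
      Λ - M + 0# + (θ₁ * 0# - (K - M))
        ≈⟨ solve 4 (λ l m x k → l :- m :+ :0 :+ (x :* :0 :- (k :- m)) := :0 :- (k :- l)) refl Λ M θ₁ K ⟩
      0# - (K - Λ) ∎) 0≤θ₁))

  -- An eigenvector for `- m` has sum zero, because `K` and `- m` differ. Evaluating A² f at a
  -- vertex where `f` does not vanish then shows that `- m` is a root of the quadratic, and Vieta
  -- determines the other root.
  smallestEigenvalue-root : ∀ {m} → IsSmallestEigenvalue (- m) →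
                            Positive m × RootPair (- m) (Λ - M + m)
  smallestEigenvalue-root {m} ((f , f≉0 , Af) , smallest) = m>0 , sum≈ , product≈
    where
    m>0 : Positive m
    m>0 = let θ , -θ>0 , eigenvalue = negativeEigenvalue in Positive-mono -θ>0 (0≤-⇒≤ (0≤-resp-≈
      (solve 2 (λ t m → t :- (:- m) := m :- (:- t)) refl θ m) (≤⇒0≤- (smallest θ eigenvalue))))

    ∑f≈0 : sum f ≈ 0#
    ∑f≈0 = *-cancelˡ (proj₂ (+-positiveˡ K-positive (proj₁ m>0))) (begin
      (K + m) * sum f
        ≈⟨ solve 3 (λ k m s → (k :+ m) :* s := k :* s :- (:- m) :* s) refl K m (sum f) ⟩
      K * sum f - - m * sum f    ≈⟨ +-cong (sym (∑-A∙ f)) (-‿cong (*-distribˡ-sum (- m) f)) ⟩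
      sum (A∙ f) - ∑[ x < v ] (- m * f x) ≈⟨ +-congʳ (∑-cong Af) ⟩
      ∑[ x < v ] (- m * f x) - ∑[ x < v ] (- m * f x) ≈⟨ -‿inverseʳ _ ⟩
      0#                         ≈⟨ zeroʳ _ ⟨
      (K + m) * 0#               ∎)

    sum≈ : Λ - M ≈ - m + (Λ - M + m)
    sum≈ = solve 2 (λ a m → a := (:- m) :+ (a :+ m)) refl (Λ - M) m

    product≈ : K - M ≈ - (- m * (Λ - M + m))
    product≈ = *-cancelˡ fx≉0 (begin
      f x * (K - M)
        ≈⟨ solve 4 (λ f b a m → f :* b :=
             (a :* ((:- m) :* f) :+ b :* f :+ :0) :- a :* ((:- m) :* f)) refl (f x) (K - M) (Λ - M) m ⟩
      (Λ - M) * (- m * f x) + (K - M) * f x + 0# - (Λ - M) * (- m * f x)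
        ≈⟨ +-congʳ eigen² ⟨
      - m * (- m * f x) - (Λ - M) * (- m * f x)
        ≈⟨ solve 3 (λ f a m → (:- m) :* ((:- m) :* f) :- a :* ((:- m) :* f) :=
             f :* (:- ((:- m) :* (a :+ m)))) refl (f x) (Λ - M) m ⟩
      f x * - (- m * (Λ - M + m)) ∎)
      where
      x = proj₁ (¬∀⟶∃¬ v (λ x → f x ≈ 0#) (λ x → f x ≟ 0#) f≉0)
      fx≉0 = proj₂ (¬∀⟶∃¬ v (λ x → f x ≈ 0#) (λ x → f x ≟ 0#) f≉0)

      eigen² : - m * (- m * f x) ≈ (Λ - M) * (- m * f x) + (K - M) * f x + 0#
      eigen² = begin
        - m * (- m * f x)             ≈⟨ *-congˡ (Af x) ⟨
        - m * A∙ f x                  ≈⟨ *-distribˡ-sum (- m) (λ y → A x y * f y) ⟩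
        ∑[ y < v ] (- m * (A x y * f y))
          ≈⟨ ∑-cong (λ y → solve 3 (λ m a f → m :* (a :* f) := a :* (m :* f)) refl (- m) (A x y) (f y)) ⟩
        A∙ (λ y → - m * f y) x        ≈⟨ A∙-cong Af x ⟨
        A∙ (A∙ f) x                   ≈⟨ A∙² f x ⟩
        (Λ - M) * A∙ f x + (K - M) * f x + M * sum f
          ≈⟨ +-cong (+-congʳ (*-congˡ (Af x))) (trans (*-congˡ ∑f≈0) (zeroʳ M)) ⟩
        (Λ - M) * (- m * f x) + (K - M) * f x + 0# ∎

-- Parameters in terms of `m`, `d` and `s`.

module DelsarteClique
  (ℝ : RealNumbers) {v k λ′ μ : ℕ} (Γ : Graph v)
  (stronglyRegular : Graph.IsStronglyRegular Γ k λ′ μ)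
  (¬complete : ¬ Graph.Complete Γ)
  {m : RealNumbers.Carrier ℝ}
  (smallest : Spectrum.IsSmallestEigenvalue ℝ Γ (RealNumbers.-_ ℝ m))
  {C : Subset v} (delsarte : Spectrum.IsDelsarteClique ℝ Γ k m C)
  where

  open RealNumbers ℝ hiding (zero)
  open Graph Γ using (_∼_; _∼?_)
  open Spectrum ℝ Γ renaming (adjacencyMatrix to A)
  open IntegerCoefficients commutativeRing
    using (solve; _:+_; _:*_; _:-_; :-_; _:=_; :0; :1; Polynomial)
  open OrderedField ℝ
  open FiniteSums ℝ
  open StronglyRegular ℝ Γ stronglyRegular ¬complete
  open SetoidReasoning setoid

  m-positive : Positive m
  m-positive = proj₁ (smallestEigenvalue-root smallest)

  -- d + 1 is the order of C, and s = μ / m is the number of neighbours in C of a vertex outside C.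
  d s : Carrier
  d = K / m
  s = M / m

  m*[x/m]≈x : ∀ x → m * (x / m) ≈ x
  m*[x/m]≈x x = begin
    m * (x * m ⁻¹)   ≈⟨ solve 3 (λ m x i → m :* (x :* i) := x :* (m :* i)) refl m x (m ⁻¹) ⟩
    x * (m * m ⁻¹)   ≈⟨ *-congˡ (*-inverseʳ (proj₂ m-positive)) ⟩
    x * 1#           ≈⟨ *-identityʳ x ⟩
    x                ∎

  K≈md : K ≈ m * d
  K≈md = sym (m*[x/m]≈x K)

  M≈ms : M ≈ m * s
  M≈ms = sym (m*[x/m]≈x M)

  d-positive : Positive d
  d-positive = *-cancelˡ-positive m-positive (Positive-resp-≈ K≈md K-positive)

  s-positive : Positive s
  s-positive = *-cancelˡ-positive m-positive (Positive-resp-≈ M≈ms M-positive)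

  m*[d-s]≈K-M : m * (d - s) ≈ K - M
  m*[d-s]≈K-M = trans (solve 3 (λ m d s → m :* (d :- s) := m :* d :- m :* s) refl m d s)
    (+-cong (sym K≈md) (-‿cong (sym M≈ms)))

  0≤d-s : 0# ≤ d - s
  0≤d-s = *-cancelˡ-nonneg m-positive (0≤-resp-≈ (sym m*[d-s]≈K-M) 0≤K-M)

  -- The roots have product `M - K`, so the root other than `- m` is (K - M) / m.
  r≈d-s : Λ - M + m ≈ d - s
  r≈d-s = *-cancelˡ (proj₂ m-positive) (begin
    m * (Λ - M + m)         ≈⟨ solve 2 (λ m r → m :* r := :- ((:- m) :* r)) refl m (Λ - M + m) ⟩
    - (- m * (Λ - M + m))   ≈⟨ proj₂ (proj₂ (smallestEigenvalue-root smallest)) ⟨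
    K - M                   ≈⟨ m*[d-s]≈K-M ⟨
    m * (d - s)             ∎)

  roots : RootPair (- m) (d - s)
  roots = trans (solve 2 (λ a m → a := (:- m) :+ (a :+ m)) refl (Λ - M) m) (+-congˡ r≈d-s)
        , trans (sym m*[d-s]≈K-M) (solve 2 (λ m r → m :* r := :- ((:- m) :* r)) refl m (d - s))

  -- Both orders occur: the clique is tested with A - (d - s), and the vector `u` below with A + m.
  roots′ : RootPair (d - s) (- m)
  roots′ = trans (proj₁ roots) (+-comm _ _) , trans (proj₂ roots) (-‿cong (*-comm _ _))

  -- Applying the quadratic relation to the all-ones vector gives K² = (Λ - M) K + (K - M) + M V,
  -- which is solved for M V = m V s and divided by `m`.
  Vs≈ : V * s ≈ ((m - 1#) * d + s) * (1# + d)
  Vs≈ = *-cancelˡ (proj₂ m-positive) (begin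
    m * (V * s)
      ≈⟨ solve 6 (λ V s m k b l → m :* (V :* s) :=
           l :* (k :* :1) :+ b :* :1 :+ m :* s :* (:1 :* V) :- (l :* (k :* :1) :+ b :* :1))
           refl V s m K (K - M) (Λ - M) ⟩
    (Λ - M) * (K * 1#) + (K - M) * 1# + m * s * (1# * V) - rest
      ≈⟨ +-congʳ A²1 ⟨
    K * (K * 1#) - rest
      ≈⟨ +-cong (*-cong K≈md (*-congʳ K≈md))
           (-‿cong (+-cong (*-cong (proj₁ roots) (*-congʳ K≈md)) (*-congʳ (proj₂ roots)))) ⟩
    m * d * (m * d * 1#) - ((- m + (d - s)) * (m * d * 1#) + - (- m * (d - s)) * 1#)
      ≈⟨ solve 3 (λ m d s →
           m :* d :* (m :* d :* :1) :- ((:- m :+ (d :- s)) :* (m :* d :* :1) :+ (:- (:- m :* (d :- s))) :* :1)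
           := m :* (((m :- :1) :* d :+ s) :* (:1 :+ d))) refl m d s ⟩
    m * (((m - 1#) * d + s) * (1# + d)) ∎)
    where
    -- Any vertex serves for evaluating the relation; the path shows that there is one.
    x = proj₁ path
    rest = (Λ - M) * (K * 1#) + (K - M) * 1#

    A²1 : K * (K * 1#) ≈ (Λ - M) * (K * 1#) + (K - M) * 1# + m * s * (1# * V)
    A²1 = begin
      K * (K * 1#)              ≈⟨ A∙-const (K * 1#) x ⟨
      A∙ (λ _ → K * 1#) x       ≈⟨ A∙-cong (A∙-const 1#) x ⟨
      A∙ (A∙ (λ _ → 1#)) x      ≈⟨ A∙² (λ _ → 1#) x ⟩
      (Λ - M) * A∙ (λ _ → 1#) x + (K - M) * 1# + M * ∑[ y < v ] 1#
        ≈⟨ +-cong (+-congʳ (*-congˡ (A∙-const 1# x))) (*-cong M≈ms (∑-const v 1#)) ⟩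
      (Λ - M) * (K * 1#) + (K - M) * 1# + m * s * (1# * V) ∎

  -- The characteristic vector of the clique.

  χ : Fin v → Carrier
  χ y = indicator (lookup C y)

  ∑χ : sum χ ≈ 1# + d
  ∑χ = trans (∑-indicator C) (proj₂ delsarte)

  -- On vectors supported on a clique, A acts inside the clique as J - I. The factor `g y` discards
  -- the values at vertices outside it.
  A∙-clique : ∀ {g} → (∀ z → χ z * g z ≈ g z) → ∀ y → g y * A∙ g y ≈ g y * (sum g - g y)
  A∙-clique {g} supported y with lookup C y in Cy
  ... | false = trans (*-congʳ gy≈0) (trans (zeroˡ _) (sym (trans (*-congʳ gy≈0) (zeroˡ _))))
    where
    gy≈0 : g y ≈ 0#
    gy≈0 = trans (sym (supported y)) (trans (*-congʳ (reflexive (≡.cong indicator Cy))) (zeroˡ _))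
  ... | true = *-congˡ (begin
    ∑[ z < v ] (A y z * g z)
      ≈⟨ ∑-cong (λ z → entry z (y ≟ꟳ z) (lookup C z) ≡.refl) ⟩
    ∑[ z < v ] (1# * g z + - 1# * (δ y z * g z))
      ≈⟨ ∑-linear 1# (- 1#) g (λ z → δ y z * g z) ⟩
    1# * sum g + - 1# * ∑[ z < v ] (δ y z * g z)
      ≈⟨ +-congˡ (*-congˡ (∑-δ y g)) ⟩
    1# * sum g + - 1# * g y
      ≈⟨ solve 2 (λ s g → :1 :* s :+ (:- :1) :* g := s :- g) refl (sum g) (g y) ⟩
    sum g - g y ∎)
    where
    entry : ∀ z → Dec (y ≡ z) → ∀ b → lookup C z ≡ b → A y z * g z ≈ 1# * g z + - 1# * (δ y z * g z)
    entry z (yes ≡.refl) _ _ = begin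
      A y y * g y                         ≈⟨ *-congʳ (A-diag y) ⟩
      0# * g y
        ≈⟨ solve 1 (λ g → :0 :* g := :1 :* g :+ (:- :1) :* (:1 :* g)) refl (g y) ⟩
      1# * g y + - 1# * (1# * g y)        ≈⟨ +-congˡ (*-congˡ (*-congʳ (δ-diag y))) ⟨
      1# * g y + - 1# * (δ y y * g y)     ∎
    entry z (no y≢z) true Cz = begin
      A y z * g z
        ≈⟨ *-congʳ (A-adj (proj₁ delsarte y z (lookup⇒[]= y C Cy) (lookup⇒[]= z C Cz) y≢z)) ⟩
      1# * g z
        ≈⟨ solve 1 (λ g → :1 :* g := :1 :* g :+ (:- :1) :* (:0 :* g)) refl (g z) ⟩
      1# * g z + - 1# * (0# * g z)        ≈⟨ +-congˡ (*-congˡ (*-congʳ (δ-off y≢z))) ⟨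
      1# * g z + - 1# * (δ y z * g z)     ∎
    entry z (no y≢z) false Cz = begin
      A y z * g z                         ≈⟨ *-congˡ gz≈0 ⟩
      A y z * 0#
        ≈⟨ solve 2 (λ a e → a :* :0 := :1 :* :0 :+ (:- :1) :* (e :* :0)) refl (A y z) (δ y z) ⟩
      1# * 0# + - 1# * (δ y z * 0#)       ≈⟨ +-cong (*-congˡ gz≈0) (*-congˡ (*-congˡ gz≈0)) ⟨
      1# * g z + - 1# * (δ y z * g z)     ∎
      where
      gz≈0 : g z ≈ 0#
      gz≈0 = trans (sym (supported z)) (trans (*-congʳ (reflexive (≡.cong indicator Cz))) (zeroˡ _))

  χ-idem : ∀ y → χ y * χ y ≈ χ y
  χ-idem y = indicator-idem (lookup C y)

  -- Equality in the Delsarte bound makes χ - (d + 1) / v an eigenvector for d - s.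
  A∙χ : ∀ x → A∙ χ x ≈ s + (d - s) * χ x
  A∙χ x = begin
    A∙ χ x
      ≈⟨ solve 4 (λ a r c s → a := (a :+ (:- r) :* c :- s) :+ (s :+ r :* c)) refl (A∙ χ x) (d - s) (χ x) s ⟩
    (w x - s) + (s + (d - s) * χ x)        ≈⟨ +-congʳ (∑sq≈0⇒≈0 (λ y → w y - s) ∑[w-s]²≈0 x) ⟩
    0# + (s + (d - s) * χ x)               ≈⟨ +-identityˡ _ ⟩
    s + (d - s) * χ x                      ∎
    where
    w : Fin v → Carrier
    w = (A- (d - s) ∙) χ

    ∑w : sum w ≈ (m * d - (d - s)) * (1# + d)
    ∑w = begin
      ∑[ y < v ] (A∙ χ y + - (d - s) * χ y)       ≈⟨ ∑-cong (λ y → +-congʳ (sym (*-identityˡ (A∙ χ y)))) ⟩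
      ∑[ y < v ] (1# * A∙ χ y + - (d - s) * χ y)  ≈⟨ ∑-linear 1# (- (d - s)) (A∙ χ) χ ⟩
      1# * sum (A∙ χ) + - (d - s) * sum χ         ≈⟨ +-cong (*-congˡ (∑-A∙ χ)) refl ⟩
      1# * (K * sum χ) + - (d - s) * sum χ
        ≈⟨ solve 3 (λ k r c → :1 :* (k :* c) :+ (:- r) :* c := (k :- r) :* c) refl K (d - s) (sum χ) ⟩
      (K - (d - s)) * sum χ                       ≈⟨ *-cong (+-congʳ K≈md) ∑χ ⟩
      (m * d - (d - s)) * (1# + d)                ∎

    ∑χw : ∑[ y < v ] (χ y * w y) ≈ s * (1# + d)
    ∑χw = begin
      ∑[ y < v ] (χ y * w y)
        ≈⟨ ∑-cong (λ y → begin
             χ y * w y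
               ≈⟨ solve 3 (λ c a r → c :* (a :+ (:- r) :* c)
                    := c :* a :- r :* (c :* c)) refl (χ y) (A∙ χ y) (d - s) ⟩
             χ y * A∙ χ y - (d - s) * (χ y * χ y)
               ≈⟨ +-congʳ (trans (A∙-clique χ-idem y) (*-congˡ (+-congʳ ∑χ))) ⟩
             χ y * (1# + d - χ y) - (d - s) * (χ y * χ y)
               ≈⟨ solve 3 (λ c d s → c :* (:1 :+ d :- c) :- (d :- s) :* (c :* c)
                    := (:1 :+ d) :* c :- (:1 :+ d :- s) :* (c :* c)) refl (χ y) d s ⟩
             (1# + d) * χ y - (1# + d - s) * (χ y * χ y)
               ≈⟨ +-congˡ (-‿cong (*-congˡ (χ-idem y))) ⟩
             (1# + d) * χ y - (1# + d - s) * χ y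
               ≈⟨ solve 3 (λ c d s → (:1 :+ d) :* c :- (:1 :+ d :- s) :* c := s :* c) refl (χ y) d s ⟩
             s * χ y ∎) ⟩
      ∑[ y < v ] (s * χ y)  ≈⟨ *-distribˡ-sum s χ ⟨
      s * sum χ             ≈⟨ *-congˡ ∑χ ⟩
      s * (1# + d)          ∎

    ∑[w-s]²≈0 : ∑[ y < v ] ((w y - s) * (w y - s)) ≈ 0#
    ∑[w-s]²≈0 = begin
      ∑[ y < v ] ((w y - s) * (w y - s))
        ≈⟨ ∑[f-τ]² w s ⟩
      ∑[ y < v ] (w y * w y) - (s + s) * sum w + s * s * V
        ≈⟨ +-cong (+-cong (∑[A-θ]² roots′ χ)
             (-‿cong (*-congˡ ∑w))) (trans (*-assoc s s V) (*-congˡ (trans (*-comm s V) Vs≈))) ⟩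
      ((- m - (d - s)) * ∑[ y < v ] (χ y * w y) + M * (sum χ * sum χ))
        - (s + s) * ((m * d - (d - s)) * (1# + d)) + s * (((m - 1#) * d + s) * (1# + d))
        ≈⟨ +-congʳ (+-congʳ (+-cong (*-congˡ ∑χw) (*-cong M≈ms (*-cong ∑χ ∑χ)))) ⟩
      ((- m - (d - s)) * (s * (1# + d)) + m * s * ((1# + d) * (1# + d)))
        - (s + s) * ((m * d - (d - s)) * (1# + d)) + s * (((m - 1#) * d + s) * (1# + d))
        ≈⟨ solve 3 (λ m d s →
             ((:- m :- (d :- s)) :* (s :* (:1 :+ d)) :+ m :* s :* ((:1 :+ d) :* (:1 :+ d)))
             :- (s :+ s) :* ((m :* d :- (d :- s)) :* (:1 :+ d)) :+ s :* (((m :- :1) :* d :+ s) :* (:1 :+ d))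
             := :0) refl m d s ⟩
      0# ∎

  -- Vertices outside the clique and the range of `m`.

  outside : ∃ λ x → lookup C x ≡ false
  outside = decidable-stable (any? (λ x → lookup C x Bool.≟ false)) λ ¬outside →
    let inside x = lookup⇒[]= x C (Bool.¬-not (λ Cx≡false → ¬outside (x , Cx≡false)))
    in ¬complete (λ x y → proj₁ delsarte x y (inside x) (inside y))

  χ-outside : ∀ {x} → lookup C x ≡ false → χ x ≈ 0#
  χ-outside x∉C = reflexive (≡.cong indicator x∉C)

  V-[1+d]-positive : Positive (V - (1# + d))
  V-[1+d]-positive = Positive-mono 1-positive (≤-resp-≈ one total-outside
    (term≤∑ (λ y → indicator≤1 (lookup C y)) (proj₁ outside)))
    where
    one : 1# - χ (proj₁ outside) ≈ 1#
    one = trans (+-congˡ (-‿cong (χ-outside (proj₂ outside)))) (solve 0 (:1 :- :0 := :1) refl)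

    total-outside : ∑[ y < v ] (1# - χ y) ≈ V - (1# + d)
    total-outside = begin
      ∑[ y < v ] (1# - χ y)
        ≈⟨ ∑-cong (λ y → solve 1 (λ c → :1 :- c := :1 :* :1 :+ (:- :1) :* c) refl (χ y)) ⟩
      ∑[ y < v ] (1# * 1# + - 1# * χ y)
        ≈⟨ ∑-linear 1# (- 1#) (λ _ → 1#) χ ⟩
      1# * ∑[ y < v ] 1# + - 1# * sum χ
        ≈⟨ +-cong (*-congˡ (∑-const v 1#)) (*-congˡ ∑χ) ⟩
      1# * (1# * V) + - 1# * (1# + d)
        ≈⟨ solve 2 (λ V d → :1 :* (:1 :* V) :+ (:- :1) :* (:1 :+ d) := V :- (:1 :+ d)) refl V d ⟩
      V - (1# + d) ∎

  -- Edges leaving the clique are counted twice: `Vs≈` rearranges to s (V - (1 + d)) = (1 + d)(m -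
  -- 1) d, and the left side is positive.
  [m-1]d-positive : Positive ((m - 1#) * d)
  [m-1]d-positive = *-cancelˡ-positive (+-positiveˡ 1-positive (proj₁ d-positive)) (Positive-resp-≈ (begin
    s * (V - (1# + d))
      ≈⟨ solve 3 (λ s V d → s :* (V :- (:1 :+ d)) := V :* s :- s :* (:1 :+ d)) refl s V d ⟩
    V * s - s * (1# + d)                              ≈⟨ +-congʳ Vs≈ ⟩
    ((m - 1#) * d + s) * (1# + d) - s * (1# + d)
      ≈⟨ solve 3 (λ m s d → ((m :- :1) :* d :+ s) :* (:1 :+ d) :- s :* (:1 :+ d)
                                                           := (:1 :+ d) :* ((m :- :1) :* d)) refl m s d ⟩
    (1# + d) * ((m - 1#) * d)                         ∎)
    (*-positive s-positive V-[1+d]-positive))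

  0≤m-1 : 0# ≤ m - 1#
  0≤m-1 = *-cancelˡ-nonneg d-positive (0≤-resp-≈ (*-comm (m - 1#) d) (proj₁ [m-1]d-positive))

  -- This is the gap between the eigenvalues `d - s` and `- m`.
  d-s+m-positive : Positive (d - s + m)
  d-s+m-positive = Positive-resp-≈ (+-comm m (d - s)) (+-positiveˡ m-positive 0≤d-s)

  -- With u = (m - 1) d e_x - d χ_{C ∩ Γ(x)} + s χ, the image of u in the eigenspace of d - s is
  -- the component of the image of (m - 1) d e_x orthogonal to the images of the e_p, p ∈ C, and
  -- (A + m) u - m s is d - s + m times this component.
  module _ (x : Fin v) (x∉C : lookup C x ≡ false) where
    α : Carrier
    α = (m - 1#) * d

    N g u w : Fin v → Carrier
    N y = A x y * χ y
    g y = s * χ y + - d * N y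
    u y = α * δ x y + 1# * g y
    w   = (A- (- m) ∙) u

    -- The sum is `A∙ χ x`, which `A∙χ` evaluates at a vertex with `χ x` zero.
    ∑N : sum N ≈ s
    ∑N = trans (A∙χ x) (trans (+-congˡ (trans (*-congˡ (χ-outside x∉C)) (zeroʳ _))) (+-identityʳ s))

    χN≈N : ∀ y → χ y * N y ≈ N y
    χN≈N y = trans (solve 2 (λ c a → c :* (a :* c)
         := a :* (c :* c)) refl (χ y) (A x y)) (*-congˡ (χ-idem y))

    AN≈N : ∀ y → A x y * N y ≈ N y
    AN≈N y = trans (sym (*-assoc _ _ _)) (*-congʳ (indicator-idem (does (x ∼? y))))

    NN≈N : ∀ y → N y * N y ≈ N y
    NN≈N y = trans (*-assoc (A x y) (χ y) (N y)) (trans (*-congˡ (χN≈N y)) (AN≈N y))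

    χg≈g : ∀ y → χ y * g y ≈ g y
    χg≈g y = begin
      χ y * (s * χ y + - d * N y)
        ≈⟨ solve 4 (λ c s e n → c :* (s :* c :+ e :* n) := s :* (c :* c) :+ e :* (c :* n))
                                               refl (χ y) s (- d) (N y) ⟩
      s * (χ y * χ y) + - d * (χ y * N y) ≈⟨ +-cong (*-congˡ (χ-idem y)) (*-congˡ (χN≈N y)) ⟩
      s * χ y + - d * N y                 ∎

    gx≈0 : g x ≈ 0#
    gx≈0 = trans (sym (χg≈g x)) (trans (*-congʳ (χ-outside x∉C)) (zeroˡ _))

    ∑g : sum g ≈ s
    ∑g = begin
      sum g                       ≈⟨ ∑-linear s (- d) χ N ⟩
      s * sum χ + - d * sum N     ≈⟨ +-cong (*-congˡ ∑χ) (*-congˡ ∑N) ⟩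
      s * (1# + d) + - d * s      ≈⟨ solve 2 (λ s d → s :* (:1 :+ d) :+ (:- d) :* s := s) refl s d ⟩
      s                           ∎

    -- Only the neighbours of `x` in C contribute: there are `s` of them, and `g` equals `s - d` on
    -- each.
    A∙g : A∙ g x ≈ (s - d) * s
    A∙g = begin
      ∑[ y < v ] (A x y * (s * χ y + - d * N y))
        ≈⟨ ∑-cong (λ y → trans
             (solve 5 (λ a s c d n → a :* (s :* c :+ (:- d) :* n)
                  := s :* (a :* c) :+ (:- d) :* (a :* n)) refl (A x y) s (χ y) d (N y))
             (+-congˡ (*-congˡ (AN≈N y)))) ⟩
      ∑[ y < v ] (s * N y + - d * N y)
        ≈⟨ ∑-linear s (- d) N N ⟩
      s * sum N + - d * sum N
        ≈⟨ solve 3 (λ s d n → s :* n :+ (:- d) :* n := (s :- d) :* n) refl s d (sum N) ⟩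
      (s - d) * sum N
        ≈⟨ *-congˡ ∑N ⟩
      (s - d) * s ∎

    -- The functions `χ` and `N` take the values 0 and 1 and `N` lies below `χ`, so every product in
    -- the expansion collapses to one of them.
    ∑g² : ∑[ y < v ] (g y * g y) ≈ s * s * (1# + d) + (d * d - (s + s) * d) * s
    ∑g² = begin
      ∑[ y < v ] (g y * g y)
        ≈⟨ ∑-cong (λ y → trans
             (solve 4 (λ s c d n → (s :* c :+ (:- d) :* n) :* (s :* c :+ (:- d) :* n)
               := s :* s :* (c :* c) :+ (d :* d :* (n :* n) :- (s :+ s) :* d :* (c :* n)))
               refl s (χ y) d (N y))
             (trans (+-cong (*-congˡ (χ-idem y)) (+-cong (*-congˡ (NN≈N y)) (-‿cong (*-congˡ (χN≈N y)))))
               (solve 4 (λ s c d n → s :* s :* c :+ (d :* d :* n :- (s :+ s) :* d :* n)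
                 := s :* s :* c :+ (d :* d :- (s :+ s) :* d) :* n) refl s (χ y) d (N y)))) ⟩
      ∑[ y < v ] (s * s * χ y + (d * d - (s + s) * d) * N y)
        ≈⟨ ∑-linear (s * s) (d * d - (s + s) * d) χ N ⟩
      s * s * sum χ + (d * d - (s + s) * d) * sum N
        ≈⟨ +-cong (*-congˡ ∑χ) (*-congˡ ∑N) ⟩
      s * s * (1# + d) + (d * d - (s + s) * d) * s ∎

    ∑u : sum u ≈ α + s
    ∑u = begin
      sum u                       ≈⟨ ∑-linear α 1# (δ x) g ⟩
      α * sum (δ x) + 1# * sum g  ≈⟨ +-cong (*-congˡ (∑δ≈1 x)) (*-congˡ ∑g) ⟩
      α * 1# + 1# * s             ≈⟨ +-cong (*-identityʳ α) (*-identityˡ s) ⟩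
      α + s                       ∎

    A∙u : ∀ y → A∙ u y ≈ α * A x y + A∙ g y
    A∙u y = trans (A∙-linear α 1# (δ x) g y)
      (+-cong (*-congˡ (trans (A∙δ x y) (A-sym y x))) (*-identityˡ _))

    wx≈ : w x ≈ (s - d) * s + m * α
    wx≈ = begin
      A∙ u x + - - m * (α * δ x x + 1# * g x)
        ≈⟨ +-cong (trans (A∙u x) (+-cong (*-congˡ (A-diag x)) A∙g)) (*-congˡ (+-cong (*-congˡ (δ-diag x))
             (*-congˡ gx≈0))) ⟩
      (α * 0# + (s - d) * s) + - - m * (α * 1# + 1# * 0#)
        ≈⟨ solve 3 (λ a b m → (a :* :0 :+ b) :+ (:- (:- m)) :* (a :* :1 :+ :1 :* :0)
             := b :+ m :* a) refl α ((s - d) * s) m ⟩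
      (s - d) * s + m * α ∎

    gδ≈0 : ∀ y → g y * δ x y ≈ 0#
    gδ≈0 y = vanish (x ≟ꟳ y)
      where
      vanish : Dec (x ≡ y) → g y * δ x y ≈ 0#
      vanish (yes ≡.refl) = trans (*-congʳ gx≈0) (zeroˡ _)
      vanish (no x≢y)     = trans (*-congˡ (δ-off x≢y)) (zeroʳ _)

    -- `A∙-clique` applies to `g`, which is supported on C, and the cross term with `δ x` vanishes
    -- because `x` lies outside C.
    gw≈ : ∀ y → g y * w y ≈ α * (A x y * g y) + (sum g * g y + (m - 1#) * (g y * g y))
    gw≈ y = begin
      g y * (A∙ u y + - - m * (α * δ x y + 1# * g y))
        ≈⟨ *-congˡ (+-congʳ (A∙u y)) ⟩
      g y * ((α * A x y + A∙ g y) + - - m * (α * δ x y + 1# * g y))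
        ≈⟨ solve 6 (λ g b a t m e → g :* ((b :* a :+ t) :+ (:- (:- m)) :* (b :* e :+ :1 :* g))
             := b :* (a :* g) :+ (g :* t :+ m :* (g :* g) :+ m :* b :* (g :* e)))
             refl (g y) α (A x y) (A∙ g y) m (δ x y) ⟩
      α * (A x y * g y) + (g y * A∙ g y + m * (g y * g y) + m * α * (g y * δ x y))
        ≈⟨ +-congˡ (+-cong (+-congʳ (A∙-clique χg≈g y)) (*-congˡ (gδ≈0 y))) ⟩
      α * (A x y * g y) + (g y * (sum g - g y) + m * (g y * g y) + m * α * 0#)
        ≈⟨ +-congˡ (solve 4 (λ g G m b → g :* (G :- g) :+ m :* (g :* g) :+ m :* b :* :0
             := G :* g :+ (m :- :1) :* (g :* g)) refl (g y) (sum g) m α) ⟩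
      α * (A x y * g y) + (sum g * g y + (m - 1#) * (g y * g y)) ∎

    ∑gw : ∑[ y < v ] (g y * w y) ≈ α * ((s - d) * s) + (s * s + (m - 1#) * (s * s * (1# + d) + (d * d - (s + s) * d) * s))
    ∑gw = begin
      ∑[ y < v ] (g y * w y)
        ≈⟨ ∑-cong gw≈ ⟩
      ∑[ y < v ] (α * (A x y * g y) + (sum g * g y + (m - 1#) * (g y * g y)))
        ≈⟨ ∑-distrib-+ {v} (λ y → α * (A x y * g y)) (λ y → sum g * g y + (m - 1#) * (g y * g y)) ⟩
      ∑[ y < v ] (α * (A x y * g y)) + ∑[ y < v ] (sum g * g y + (m - 1#) * (g y * g y))
        ≈⟨ +-cong (sym (*-distribˡ-sum α (λ y → A x y * g y))) (∑-linear (sum g) (m - 1#) g (λ y → g y * g y)) ⟩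
      α * A∙ g x + (sum g * sum g + (m - 1#) * ∑[ y < v ] (g y * g y))
        ≈⟨ +-cong (*-congˡ A∙g) (+-cong (*-cong ∑g ∑g) (*-congˡ ∑g²)) ⟩
      α * ((s - d) * s) + (s * s + (m - 1#) * (s * s * (1# + d) + (d * d - (s + s) * d) * s)) ∎

    ∑uw : ∑[ y < v ] (u y * w y) ≈ α * ((s - d) * s + m * α) +
          (α * ((s - d) * s) + (s * s + (m - 1#) * (s * s * (1# + d) + (d * d - (s + s) * d) * s)))
    ∑uw = begin
      ∑[ y < v ] ((α * δ x y + 1# * g y) * w y)
        ≈⟨ ∑-cong (λ y → solve 4 (λ b e g w → (b :* e :+ :1 :* g) :* w
             := b :* (e :* w) :+ :1 :* (g :* w)) refl α (δ x y) (g y) (w y)) ⟩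
      ∑[ y < v ] (α * (δ x y * w y) + 1# * (g y * w y))
        ≈⟨ ∑-linear α 1# (λ y → δ x y * w y) (λ y → g y * w y) ⟩
      α * ∑[ y < v ] (δ x y * w y) + 1# * ∑[ y < v ] (g y * w y)
        ≈⟨ +-cong (*-congˡ (trans (∑-δ x w) wx≈)) (trans (*-identityˡ _) ∑gw) ⟩
      α * ((s - d) * s + m * α) +
        (α * ((s - d) * s) + (s * s + (m - 1#) * (s * s * (1# + d) + (d * d - (s + s) * d) * s))) ∎

    ∑w : sum w ≈ (m * d + m) * (α + s)
    ∑w = begin
      ∑[ y < v ] (A∙ u y + - - m * u y)        ≈⟨ ∑-cong (λ y → +-congʳ (sym (*-identityˡ (A∙ u y)))) ⟩
      ∑[ y < v ] (1# * A∙ u y + - - m * u y)   ≈⟨ ∑-linear 1# (- - m) (A∙ u) u ⟩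
      1# * sum (A∙ u) + - - m * sum u          ≈⟨ +-congʳ (*-congˡ (∑-A∙ u)) ⟩
      1# * (K * sum u) + - - m * sum u
        ≈⟨ solve 3 (λ k m u → :1 :* (k :* u) :+ (:- (:- m)) :* u := (k :+ m) :* u) refl K m (sum u) ⟩
      (K + m) * sum u                          ≈⟨ *-cong (+-congʳ K≈md) ∑u ⟩
      (m * d + m) * (α + s)                    ∎

    -- By `Vs≈` and `∑w`, the constant `m * s` is the mean of `w`, so the left side is the squared
    -- norm of the part of `w` orthogonal to the all-ones vector. With `∑[A-θ]²` at θ = - m, all
    -- terms become polynomials in `m`, `s` and `d`, and the right side is their factored form.
    ∑[w-ms]² : ∑[ y < v ] ((w y - m * s) * (w y - m * s)) ≈
               (d - s + m) * ((m - 1#) * d * (m * (m - 1#) * d - s * (d - s + m)))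
    ∑[w-ms]² = begin
      ∑[ y < v ] ((w y - m * s) * (w y - m * s))
        ≈⟨ ∑[f-τ]² w (m * s) ⟩
      ∑[ y < v ] (w y * w y) - (m * s + m * s) * sum w + m * s * (m * s) * V
        ≈⟨ +-cong (+-cong (∑[A-θ]² roots u) (-‿cong (*-congˡ ∑w)))
             (trans (solve 3 (λ m s V → m :* s :* (m :* s) :* V
                  := m :* m :* s :* (V :* s)) refl m s V) (*-congˡ Vs≈)) ⟩
      ((d - s - - m) * ∑[ y < v ] (u y * w y) + M * (sum u * sum u))
        - (m * s + m * s) * ((m * d + m) * (α + s)) + m * m * s * (((m - 1#) * d + s) * (1# + d))
        ≈⟨ +-congʳ (+-congʳ (+-cong (*-congˡ ∑uw) (*-cong M≈ms (*-cong ∑u ∑u)))) ⟩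
      ((d - s - - m) * (α * ((s - d) * s + m * α) +
          (α * ((s - d) * s) + (s * s + (m - 1#) * (s * s * (1# + d) + (d * d - (s + s) * d) * s))))
        + m * s * ((α + s) * (α + s)))
        - (m * s + m * s) * ((m * d + m) * (α + s)) + m * m * s * (((m - 1#) * d + s) * (1# + d))
        ≈⟨ solve 3 (λ m s d → let α = (m :- :1) :* d in
             ((d :- s :- (:- m)) :* (α :* ((s :- d) :* s :+ m :* α) :+
               (α :* ((s :- d) :* s) :+ (s :* s :+ (m :- :1) :* (s :* s :* (:1 :+ d) :+ (d :* d :- (s :+ s) :* d) :* s))))
             :+ m :* s :* ((α :+ s) :* (α :+ s)))
             :- (m :* s :+ m :* s) :* ((m :* d :+ m) :* (α :+ s)) :+ m :* m :* s :* (((m :- :1) :* d :+ s) :* (:1 :+ d))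
             := (d :- s :+ m) :* ((m :- :1) :* d :* (m :* (m :- :1) :* d :- s :* (d :- s :+ m))))
             refl m s d ⟩
      (d - s + m) * ((m - 1#) * d * (m * (m - 1#) * d - s * (d - s + m))) ∎

  -- The sum of squares is nonnegative and its first two factors are positive. What remains is the
  -- dimension inequality cleared of denominators.
  0≤m[m-1]d-s[d-s+m] : 0# ≤ m * (m - 1#) * d - s * (d - s + m)
  0≤m[m-1]d-s[d-s+m] = *-cancelˡ-nonneg [m-1]d-positive (*-cancelˡ-nonneg d-s+m-positive
    (0≤-resp-≈ (∑[w-ms]² (proj₁ outside) (proj₂ outside))
      (∑-nonneg (λ y → sq-nonneg (w (proj₁ outside) (proj₂ outside) y - m * s)))))

  -- The quadratic inequality for μ.

  X : Carrier
  X = K + m * m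

  -- Since (2 M - X)² = X² - 4 M (X - M) and X - (K - 4 m³ + 5 m²) = 4 m² (m - 1), the difference of
  -- the two sides is 4 (m² (m - 1) X - M (X - M)). Here m² times the preceding inequality reads M
  -- (X - M) ≤ m² (m - 1) K, and passing from `K` to `X` leaves the slack m⁴ (m - 1), which is
  -- nonnegative as m ≥ 1.
  discriminant≤[2M-X]² : X * (K - fromℕ 4 * (m * m * m) + fromℕ 5 * (m * m)) ≤ (M + M - X) * (M + M - X)
  discriminant≤[2M-X]² = 0≤-⇒≤ (0≤-resp-≈ (sym difference) (*-nonneg (fromℕ-nonneg 4)
    (+-nonneg (*-nonneg (sq-nonneg m) 0≤m[m-1]d-s[d-s+m])
      (*-nonneg (*-nonneg (sq-nonneg m) (sq-nonneg m)) 0≤m-1))))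
    where
    difference : (M + M - X) * (M + M - X) - X * (K - fromℕ 4 * (m * m * m) + fromℕ 5 * (m * m)) ≈
      fromℕ 4 * (m * m * (m * (m - 1#) * d - s * (d - s + m)) + m * m * (m * m) * (m - 1#))
    difference = begin
      (M + M - X) * (M + M - X) - X * (K - fromℕ 4 * (m * m * m) + fromℕ 5 * (m * m))
        ≈⟨ solve 3 (λ k n m → (n :+ n :- (k :+ m :* m)) :* (n :+ n :- (k :+ m :* m))
               :- (k :+ m :* m) :* (k :- :4 :* (m :* m :* m) :+ :5 :* (m :* m))
             := :4 :* (m :* m :* (m :- :1) :* (k :+ m :* m) :- n :* (k :+ m :* m :- n))) refl K M m ⟩
      fromℕ 4 * (m * m * (m - 1#) * (K + m * m) - M * (K + m * m - M))
        ≈⟨ *-congˡ (+-cong (*-congˡ (+-congʳ K≈md)) (-‿cong (*-cong M≈ms (+-cong (+-congʳ K≈md)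
             (-‿cong M≈ms))))) ⟩
      fromℕ 4 * (m * m * (m - 1#) * (m * d + m * m) - m * s * (m * d + m * m - m * s))
        ≈⟨ *-congˡ (solve 3 (λ m s d → m :* m :* (m :- :1) :* (m :* d :+ m :* m) :- m :* s :* (m :* d :+ m :* m :- m :* s)
             := m :* m :* (m :* (m :- :1) :* d :- s :* (d :- s :+ m)) :+ m :* m :* (m :* m) :* (m :- :1))
             refl m s d) ⟩
      fromℕ 4 * (m * m * (m * (m - 1#) * d - s * (d - s + m)) + m * m * (m * m) * (m - 1#)) ∎
      where
      -- The nested sums ending in `:0` reproduce how `fromℕ 4` and `fromℕ 5` unfold.
      :4 :5 : ∀ {n} → Polynomial n
      :4 = :1 :+ (:1 :+ (:1 :+ (:1 :+ :0)))
      :5 = :1 :+ :4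

proposition3p3 : (ℝ : RealNumbers) → let open RealNumbers ℝ in
    {v k λ′ μ : ℕ} (Γ : Graph v) → let open Graph Γ in let open Spectrum ℝ Γ in
    IsStronglyRegular k λ′ μ →
    ¬ Complete →
    (m : Carrier) →
    IsSmallestEigenvalue (- m) →
    let K  = fromℕ k
        m² = m * m
        m³ = m² * m
        Δ  = (K + m²) * (K - fromℕ 4 * m³ + fromℕ 5 * m²)
    in
    m² * (fromℕ 4 * m - fromℕ 5) ≤ K →
    ∃ (IsDelsarteClique k m) →
    fromℕ μ ≤ (K + m² - √ Δ) / fromℕ 2 ⊎ (K + m² + √ Δ) / fromℕ 2 ≤ fromℕ μ
proposition3p3 ℝ Γ stronglyRegular ¬complete m smallest _ (C , delsarte) =
  -- Here x is μ, y is k + m² and t is √Δ. A negative Δ is covered as well, since then t is 0.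
  sq≤[2x-y]²⇒outside (√-nonneg _) (√²≤ discriminant≤[2M-X]²)
  where
  open OrderedField ℝ
  open DelsarteClique ℝ Γ stronglyRegular ¬complete smallest delsarte
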